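{- Let $n$ be a positive integer and let $k,l,i,j$ be nonnegative integers. The number of permutations $\sigma\in B_n$ with $\mathrm{wex}_B(\sigma)=k$, $\mathrm{neg}(\sigma)=l$, $\mathrm{cro}_B(\sigma)=i$ and $\mathrm{nes}_B(\sigma)=j$ equals the number of permutations $\sigma\in B_n$ with $\mathrm{wex}_B(\sigma)=k$, $\mathrm{neg}(\sigma)=l$, $\mathrm{nes}_B(\sigma)=i$ and $\mathrm{cro}_B(\sigma)=j$. Equivalently, $$\sum_{\sigma\in B_n}p^{\mathrm{nes}_B(\sigma)}q^{\mathrm{cro}_B(\sigma)}y^{\mathrm{wex}_B(\sigma)}a^{\mathrm{neg}(\sigma)}=\sum_{\sigma\in B_n}p^{\mathrm{cro}_B(\sigma)}q^{\mathrm{nes}_B(\sigma)}y^{\mathrm{wex}_B(\sigma)}a^{\mathrm{neg}(\sigma)}.$$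
   Context: For a positive integer $n$, $[n]=\{1,\dots,n\}$ and $[-n,n]=\{ -n,\dots,-1,1,\dots,n\}$, ordered by the natural order of $\mathbb{Z}$. $B_n$ is the set of type $B$ permutations of rank $n$: integer sequences $\sigma=(\sigma(1),\dots,\sigma(n))$ with $\{|\sigma(1)|,\dots,|\sigma(n)|\}=[n]$; $\sigma$ is identified with a permutation of $[-n,n]$ via $\sigma(-i)=-\sigma(i)$. $\mathrm{neg}(\sigma)$ is the number of negative entries among $\sigma(1),\dots,\sigma(n)$. $\mathrm{wex}_B(\sigma)=|\{j\in[n]:\sigma(j)\ge j\}|$. The permutation diagram of $\sigma$ has vertices $-n,\dots,-1,1,\dots,n$ placed left to right on a line and, for each $i\in[-n,n]$, an arc from $i$ to $\sigma(i)$, drawn above the line if $i\le\sigma(i)$ and below otherwise. A crossing of $\sigma$ is a pair of arcs $(i,\sigma(i)),(j,\sigma(j))$, $i,j\in[n]$, satisfying $i<j\le\sigma(i)<\sigma(j)$ (upper crossing), or $-i<j\le\sigma(-i)<\sigma(j)$ (upper crossing), or $\sigma(i)<\sigma(j)<i<j$ (lower crossing). A nesting of $\sigma$ is a pair of arcs $(i,\sigma(i)),(j,\sigma(j))$, $i,j\in[n]$, satisfying $i<j\le\sigma(j)<\sigma(i)$ (upper nesting), or $-i<j\le\sigma(-j)<\sigma(i)$ (upper nesting), or $\sigma(j)<\sigma(i)<i<j$ (lower nesting). $\mathrm{cro}_B(\sigma)$ and $\mathrm{nes}_B(\sigma)$ denote the numbers of crossings and nestings of $\sigma$. (E.g. for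 $\sigma=(4,-6,3,5,1,-2)$ the paper counts $\mathrm{nes}_B(\sigma)=5$ and $\mathrm{cro}_B(\sigma)=4$.)
   Formalization: The second upper-nesting condition is corrected to -i < j ≤ σ(j) < σ(-i), matching the example nes_B = 5; as printed (-i < j ≤ σ(-j) < σ(i)) the claim fails for n=3, k=2, l=1. The equivalent generating-function form is not stated separately. -}

module Defs where

open import Data.Bool using (Bool; true; false; _∧_; _∨_; not; if_then_else_)
open import Data.Nat as ℕ using (ℕ; zero; suc)
import Data.Nat.Properties as ℕP
open import Data.Integer as ℤ using (ℤ; +_; -[1+_]; -_; _≤ᵇ_; ∣_∣)
import Data.Integer.Properties as ℤP
open import Data.List using (List; []; _∷_; map; length; filterᵇ; upTo; concatMap; _++_; reverse)
open import Data.Bool.ListAction using (any; all)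
open import Relation.Nullary.Decidable using (⌊_⌋)
open import Data.Product using (_×_; _,_)

infix 4 _<ᵇ_ _==ℕ_
_<ᵇ_ : ℤ → ℤ → Bool
a <ᵇ b = (a ℤ.+ + 1) ≤ᵇ b

_==ℕ_ : ℕ → ℕ → Bool
a ==ℕ b = ⌊ a ℕ.≟ b ⌋

[_] : ℕ → List ℕ
[ n ] = map suc (upTo n)

signedVals : ℕ → List ℤ
signedVals n = reverse (map (λ k → -[1+ k ]) (upTo n)) ++ map (λ k → + suc k) (upTo n)

seqs : ℕ → ℕ → List (List ℤ)
seqs n zero    = [] ∷ []
seqs n (suc m) = concatMap (λ x → map (x ∷_) (seqs n m)) (signedVals n)

-- the i-th entry (1-based) of a sequence; 0 outside the range
at : List ℤ → ℕ → ℤ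
at []       _             = + 0
at (x ∷ xs) zero          = + 0
at (x ∷ xs) (suc zero)    = x
at (x ∷ xs) (suc (suc i)) = at xs (suc i)

isTypeB : ℕ → List ℤ → Bool
isTypeB n σ = all (λ x → any (λ j → ∣ x ∣ ==ℕ j) [ n ]) σ
            ∧ all (λ j → any (λ x → ∣ x ∣ ==ℕ j) σ) [ n ]

-- B_n : type B permutations of rank n, as sequences (σ(1),…,σ(n))
B : ℕ → List (List ℤ)
B n = filterᵇ (isTypeB n) (seqs n n)

-- σ as a map on [-n,n]  via σ(-i) = -σ(i)
ev : List ℤ → ℤ → ℤ
ev σ (+ k)     = at σ k
ev σ -[1+ k ]  = - at σ (suc k)

countᵇ : {A : Set} → (A → Bool) → List A → ℕ
countᵇ p xs = length (filterᵇ p xs)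

neg : List ℤ → ℕ
neg σ = countᵇ (λ x → x <ᵇ + 0) σ

wexB : ℕ → List ℤ → ℕ
wexB n σ = countᵇ (λ j → (+ j) ≤ᵇ ev σ (+ j)) [ n ]

pairs : ℕ → List (ℕ × ℕ)
pairs n = concatMap (λ i → map (λ j → (i , j)) [ n ]) [ n ]

isCrossing : List ℤ → ℕ × ℕ → Bool
isCrossing σ (i , j) =
  let I = + i ; J = + j ; s = ev σ in
     ((I <ᵇ J) ∧ (J ≤ᵇ s I) ∧ (s I <ᵇ s J))
   ∨ (((- I) <ᵇ J) ∧ (J ≤ᵇ s (- I)) ∧ (s (- I) <ᵇ s J))
   ∨ ((s I <ᵇ s J) ∧ (s J <ᵇ I) ∧ (I <ᵇ J))

isNesting : List ℤ → ℕ × ℕ → Bool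
isNesting σ (i , j) =
  let I = + i ; J = + j ; s = ev σ in
     ((I <ᵇ J) ∧ (J ≤ᵇ s J) ∧ (s J <ᵇ s I))
   ∨ (((- I) <ᵇ J) ∧ (J ≤ᵇ s J) ∧ (s J <ᵇ s (- I)))
   ∨ ((s J <ᵇ s I) ∧ (s I <ᵇ I) ∧ (I <ᵇ J))

croB : ℕ → List ℤ → ℕ
croB n σ = countᵇ (isCrossing σ) (pairs n)

nesB : ℕ → List ℤ → ℕ
nesB n σ = countᵇ (isNesting σ) (pairs n)

{-# OPTIONS --safe #-}

-- A signed permutation is built from position n down to position 1.  At position j the value j
-- either becomes available or is put into a hole (a position whose value, smaller than all values
-- placed so far, is still to be chosen); then position j either becomes a hole or takes one of
-- the available values.  At the end as many values remain available as there are holes, and their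
-- negatives are put into the holes in decreasing order.  Whenever there are c places or values to
-- choose from, the choices contribute (0 , c-1), (1 , c-2), …, (c-1 , 0) to the numbers of
-- crossings and nestings, and c depends only on the kinds of the earlier steps.  So the joint
-- distribution is invariant under exchanging crossings and nestings.
module Submission where

open import Defs
open import Data.Bool using (Bool; true; false; if_then_else_; _∧_; _∨_; T)
open import Data.Bool.Properties using (T-∧; T?)
open import Data.Empty using (⊥)
open import Data.Integer as ℤ using (ℤ; +_; -[1+_]; -_; _≤ᵇ_; _≤_; _<_; +≤+; +<+; -<+; -<-; ∣_∣; _≟_; _≤?_; _<?_)
import Data.Integer.Properties as ℤ
open import Data.List using (List; []; _∷_; map; length; filter; concatMap; _++_; applyUpTo; upTo; drop; reverse)
open import Data.List.Properties using (∷-injectiveˡ; ∷-injectiveʳ; map-id-local; map-∘; map-cong; map-cong-local; map-++;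
  map-concatMap; concatMap-map; ++-assoc; length-++; length-map; length-upTo)
open import Data.List.Membership.DecPropositional _≟_ using (_∉?_; _∈?_)
open import Data.List.Membership.Propositional using (_∈_; _∉_; find; lose)
open import Data.List.Membership.Propositional.Properties
  using (∈-map⁺; ∈-map⁻; ∈-filter⁺; ∈-filter⁻; ∈-upTo⁺; ∈-upTo⁻; ∈-++⁻; ∈-++⁺ˡ; ∈-++⁺ʳ; ∈-∃++)
open import Data.List.Relation.Binary.Permutation.Propositional hiding (trans)
open import Data.List.Relation.Binary.Permutation.Propositional.Properties as ↭
  using (∈-resp-↭; shift; shifts; ++⁺; ++⁺ˡ; ++-identityʳ; ↭-length; ↭-reverse)
import Data.List.Relation.Binary.Permutation.Setoid.Properties as Setoid
open import Data.List.Relation.Unary.All as All using ([]; _∷_)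
open import Data.List.Relation.Unary.All.Properties using (all⁺; all⁻)
open import Data.List.Relation.Unary.AllPairs as AllPairs using (AllPairs; []; _∷_)
import Data.List.Relation.Unary.AllPairs.Properties as AllPairs
open import Data.List.Relation.Unary.Any as Any using (Any; here; there)
open import Data.List.Relation.Unary.Any.Properties using (concatMap⁺; concatMap⁻; any⁺; any⁻; reverse⁺; reverse⁻)
open import Data.List.Relation.Unary.Unique.Propositional using (Unique)
import Data.List.Relation.Unary.Unique.Propositional.Properties as Unique
open import Data.Nat as ℕ using (ℕ; zero; suc; pred; _+_; s≤s; z≤n; _≡ᵇ_)
open import Data.Nat.ListAction using (sum)
open import Data.Nat.ListAction.Properties using (sum-++; sum-↭)
import Data.Nat.Properties as ℕ
open import Data.Product using (_×_; _,_; proj₁; proj₂; ∃-syntax)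
open import Data.Sum as Sum using (_⊎_; inj₁; inj₂; [_,_]′)
open import Function using (_∘_; id)
open import Function.Bundles using (module Equivalence)
open import Relation.Binary.Definitions using (tri<; tri≈; tri>)
open import Relation.Binary.PropositionalEquality hiding ([_])
open import Relation.Nullary using (¬_; Dec; yes; no; does; contradiction)
open import Relation.Nullary.Decidable using (_×-dec_; dec-true; dec-false; toWitness; fromWitness)
open import Relation.Unary using (Decidable)

-- Lists and finite sums

-- Why a choice contributes these numbers. Upper arcs: when position j takes an available value,
-- every other available value will be the end of an upper arc that starts further left, at a
-- smaller position or at a negative one. A smaller such value means a crossing and a larger one a
-- nesting, wherever the arc turns out to start. Lower arcs: when a hole is filled, all other holes
-- will receive smaller values, so the holes on its left give crossings and those on its right give
-- nestings. This is why values must enter in decreasing order, the negative ones included. The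
-- definitions count pairs of positions of a complete permutation, whereas the construction sees
-- only suffixes. So each pair is charged to one position, and arcs from further left enter only
-- through the values missing from the suffix. A hole is encoded as an integer below `- n`; the same
-- sums then apply to partial words, and they equal the defined statistics once no hole is left.

private variable
  A C : Set
  P Q R : Set

∈-concatMap⁺ : ∀ {f : A → List C} {x y xs} → x ∈ xs → y ∈ f x → y ∈ concatMap f xs
∈-concatMap⁺ {f = f} x∈ y∈ = concatMap⁺ f (lose x∈ y∈)

∈-concatMap⁻ : ∀ (f : A → List C) {y} xs → y ∈ concatMap f xs → ∃[ x ] x ∈ xs × y ∈ f x
∈-concatMap⁻ f xs = find ∘ concatMap⁻ f {xs = xs}

-- g recovers the index x from any element of f x, so distinct fibres are disjoint.
concatMap-unique : ∀ {f : A → List C} (g : C → A) {xs} → Unique xs →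
  (∀ {x} → x ∈ xs → Unique (f x)) → (∀ {x y} → x ∈ xs → y ∈ f x → g y ≡ x) →
  Unique (concatMap f xs)
concatMap-unique g {[]} _ _ _ = []
concatMap-unique {f = f} g {x ∷ xs} (x∉ ∷ u) uf gf =
  Unique.++⁺ (uf (here refl)) (concatMap-unique g u (uf ∘ there) (gf ∘ there)) disjoint
  where
  disjoint : ∀ {y} → ¬ (y ∈ f x × y ∈ concatMap f xs)
  disjoint (y∈ , y∈′) with z , z∈ , y∈z ← ∈-concatMap⁻ f xs y∈′ =
    All.lookup x∉ z∈ (trans (sym (gf (here refl) y∈)) (gf (there z∈) y∈z))

concatMap-↭ : ∀ (f : A → List C) {xs ys} → xs ↭ ys → concatMap f xs ↭ concatMap f ys
concatMap-↭ f refl = refl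
concatMap-↭ f (prep x p) = ++⁺ˡ (f x) (concatMap-↭ f p)
concatMap-↭ f (swap x y p) = ↭-trans (shifts (f x) (f y)) (++⁺ˡ (f y) (++⁺ˡ (f x) (concatMap-↭ f p)))
concatMap-↭ f (_↭_.trans p q) = ↭-trans (concatMap-↭ f p) (concatMap-↭ f q)

concatMap-cong-↭ : ∀ {f g : A → List C} → (∀ x → f x ↭ g x) → ∀ xs → concatMap f xs ↭ concatMap g xs
concatMap-cong-↭ f↭g [] = refl
concatMap-cong-↭ f↭g (x ∷ xs) = ++⁺ (f↭g x) (concatMap-cong-↭ f↭g xs)

map-concatMap-local : ∀ {D E : Set} (s : C → D) (t : A → E) (f : A → List C) (g : E → List D) xs →
  (∀ {x} → x ∈ xs → map s (f x) ≡ g (t x)) → map s (concatMap f xs) ≡ concatMap g (map t xs)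
map-concatMap-local s t f g [] _ = refl
map-concatMap-local s t f g (x ∷ xs) eq = trans (map-++ s (f x) _)
  (cong₂ _++_ (eq (here refl)) (map-concatMap-local s t f g xs (eq ∘ there)))

⊆⇒↭++ : ∀ {xs ys : List A} → Unique xs → (∀ {x} → x ∈ xs → x ∈ ys) → ∃[ zs ] ys ↭ xs ++ zs
⊆⇒↭++ {xs = []} {ys} _ _ = ys , refl
⊆⇒↭++ {xs = x ∷ xs} (x∉ ∷ u) sub with us , vs , refl ← ∈-∃++ (sub (here refl)) =
  let zs , p = ⊆⇒↭++ {ys = us ++ vs} u sub′ in zs , ↭-trans (shift x us vs) (prep x p)
  where
  sub′ : ∀ {y} → y ∈ xs → y ∈ us ++ vs
  sub′ y∈ with ∈-resp-↭ (shift x us vs) (sub (there y∈))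
  ... | here refl = contradiction refl (All.lookup x∉ y∈)
  ... | there y∈′ = y∈′

⊆-length⇒↭ : ∀ {xs ys : List A} → Unique xs → (∀ {x} → x ∈ xs → x ∈ ys) →
  length xs ≡ length ys → ys ↭ xs
⊆-length⇒↭ {xs = xs} u sub len with ⊆⇒↭++ u sub
... | [] , p = ↭-trans p (++-identityʳ xs)
... | z ∷ zs , p = contradiction
  (ℕ.+-cancelˡ-≡ (length xs) 0 _ (trans (ℕ.+-identityʳ _) (trans len (trans (↭-length p) (length-++ xs)))))
  λ ()

Unique-resp-↭ : ∀ {xs ys : List A} → xs ↭ ys → Unique xs → Unique ys
Unique-resp-↭ = Setoid.Unique-resp-↭ (setoid _) ∘ ↭⇒↭ₛ

Unique-++-disjoint : ∀ xs {zs : List A} {z} → Unique (xs ++ zs) → z ∈ xs → z ∉ zs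
Unique-++-disjoint (x ∷ xs) (x∉ ∷ _) (here refl) z∈ = All.lookup x∉ (∈-++⁺ʳ xs z∈) refl
Unique-++-disjoint (x ∷ xs) (_ ∷ u) (there z∈) z∈′ = Unique-++-disjoint xs u z∈ z∈′

unique∧set⇒↭ : ∀ {xs ys : List A} → Unique xs → Unique ys →
  (∀ {x} → x ∈ xs → x ∈ ys) → (∀ {x} → x ∈ ys → x ∈ xs) → ys ↭ xs
unique∧set⇒↭ {xs = xs} u v sub sup with ⊆⇒↭++ u sub
... | [] , p = ↭-trans p (++-identityʳ xs)
... | z ∷ zs , p = contradiction (here refl)
  (Unique-++-disjoint xs (Unique-resp-↭ p v) (sup (∈-resp-↭ (↭-sym p) (∈-++⁺ʳ xs (here refl)))))

∑ : List A → (A → ℕ) → ℕ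
∑ xs f = sum (map f xs)

∑-cong : ∀ {f g : A → ℕ} xs → (∀ {x} → x ∈ xs → f x ≡ g x) → ∑ xs f ≡ ∑ xs g
∑-cong xs eq = cong sum (map-cong-local (All.tabulate eq))

∑-zero : ∀ {f : A → ℕ} xs → (∀ {x} → x ∈ xs → f x ≡ 0) → ∑ xs f ≡ 0
∑-zero [] _ = refl
∑-zero (x ∷ xs) eq = cong₂ _+_ (eq (here refl)) (∑-zero xs (eq ∘ there))

∑-++ : ∀ (f : A → ℕ) xs ys → ∑ (xs ++ ys) f ≡ ∑ xs f + ∑ ys f
∑-++ f xs ys = trans (cong sum (map-++ f xs ys)) (sum-++ (map f xs) (map f ys))

∑-map : ∀ (f : C → ℕ) (g : A → C) xs → ∑ (map g xs) f ≡ ∑ xs (f ∘ g)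
∑-map f g xs = cong sum (sym (map-∘ xs))

∑-concatMap : ∀ (f : C → ℕ) (g : A → List C) xs → ∑ (concatMap g xs) f ≡ ∑ xs (λ x → ∑ (g x) f)
∑-concatMap f g [] = refl
∑-concatMap f g (x ∷ xs) = trans (∑-++ f (g x) _) (cong (_+_ _) (∑-concatMap f g xs))

∑-↭ : ∀ (f : A → ℕ) {xs ys} → xs ↭ ys → ∑ xs f ≡ ∑ ys f
∑-↭ f p = sum-↭ (↭.map⁺ f p)

+-exchange : ∀ a b c d → (a + b) + (c + d) ≡ (a + c) + (b + d)
+-exchange a b c d = trans (ℕ.+-assoc a b _) (trans (cong (_+_ a)
  (trans (sym (ℕ.+-assoc b c d)) (trans (cong (_+ d) (ℕ.+-comm b c)) (ℕ.+-assoc c b d))))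
  (sym (ℕ.+-assoc a c _)))

∑-+ : ∀ (f g : A → ℕ) xs → ∑ xs (λ x → f x + g x) ≡ ∑ xs f + ∑ xs g
∑-+ f g [] = refl
∑-+ f g (x ∷ xs) = trans (cong (_+_ _) (∑-+ f g xs)) (+-exchange (f x) (g x) _ _)

∑-swap : ∀ (f : A → C → ℕ) xs ys → ∑ xs (λ x → ∑ ys (f x)) ≡ ∑ ys (λ y → ∑ xs (λ x → f x y))
∑-swap f [] ys = sym (∑-zero ys λ _ → refl)
∑-swap f (x ∷ xs) ys = trans (cong (_+_ _) (∑-swap f xs ys)) (sym (∑-+ (f x) _ ys))

χ : Bool → ℕ
χ b = if b then 1 else 0

ι : Dec P → ℕ
ι d = χ (does d)

ι-yes : (d : Dec P) → P → ι d ≡ 1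
ι-yes d p = cong χ (dec-true d p)

ι-no : (d : Dec P) → ¬ P → ι d ≡ 0
ι-no d ¬p = cong χ (dec-false d ¬p)

ι-cong : (d : Dec P) (e : Dec Q) → (P → Q) → (Q → P) → ι d ≡ ι e
ι-cong d (yes q) f g = ι-yes d (g q)
ι-cong d (no ¬q) f g = ι-no d (¬q ∘ f)

ι-split : (d : Dec P) (e : Dec Q) (e′ : Dec R) → (P → Q ⊎ R) → (Q → P) → (R → P) → ¬ (Q × R) →
  ι d ≡ ι e + ι e′
ι-split d (yes q) e′ f g h k = trans (ι-yes d (g q)) (cong suc (sym (ι-no e′ (k ∘ (q ,_)))))
ι-split d (no ¬q) e′ f g h k = ι-cong d e′ (λ p → case′ (f p)) h
  where
  case′ : _ ⊎ _ → _
  case′ (inj₁ q) = contradiction q ¬q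
  case′ (inj₂ r) = r

length-filter : ∀ {P : A → Set} (P? : Decidable P) xs → length (filter P? xs) ≡ ∑ xs (ι ∘ P?)
length-filter P? [] = refl
length-filter P? (x ∷ xs) with does (P? x)
... | true = cong suc (length-filter P? xs)
... | false = length-filter P? xs

∑-filter : ∀ {P Q : A → Set} (P? : Decidable P) (Q? : Decidable Q) {R : A → Set} (R? : Decidable R) xs →
  (∀ {x} → x ∈ xs → R x → P x × Q x) → (∀ {x} → P x → Q x → R x) →
  ∑ (filter P? xs) (ι ∘ Q?) ≡ ∑ xs (ι ∘ R?)
∑-filter P? Q? R? [] _ _ = refl
∑-filter P? Q? R? (x ∷ xs) f g with P? x
... | yes p = cong₂ _+_ (ι-cong (Q? x) (R? x) (g p) (proj₂ ∘ f (here refl))) (∑-filter P? Q? R? xs (f ∘ there) g)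
... | no ¬p = cong₂ _+_ (sym (ι-no (R? x) (¬p ∘ proj₁ ∘ f (here refl)))) (∑-filter P? Q? R? xs (f ∘ there) g)

∑-unique-∈ : ∀ {x : A} (_≟_ : ∀ y z → Dec (y ≡ z)) {xs} → Unique xs → x ∈ xs → ∑ xs (λ y → ι (y ≟ x)) ≡ 1
∑-unique-∈ _≟_ {_ ∷ xs} (x∉ ∷ u) (here refl) = cong₂ _+_ (ι-yes (_ ≟ _) refl)
  (∑-zero xs λ y∈ → ι-no (_ ≟ _) λ { refl → All.lookup x∉ y∈ refl })
∑-unique-∈ _≟_ (x∉ ∷ u) (there x∈) = cong₂ _+_ (ι-no (_ ≟ _) λ { refl → All.lookup x∉ x∈ refl })
  (∑-unique-∈ _≟_ u x∈)

-- The symmetric recursion for the joint distribution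

shiftˡ shiftʳ flip× : ℕ × ℕ → ℕ × ℕ
shiftˡ (d , e) = suc d , e
shiftʳ (d , e) = d , suc e
flip× (d , e) = e , d

-- ranks c = (0 , c-1), (1 , c-2), …, (c-1 , 0): the numbers of smaller and of larger elements
-- for each element of a chain of length c.
ranks : ℕ → List (ℕ × ℕ)
ranks zero = []
ranks (suc c) = (0 , c) ∷ map shiftˡ (ranks c)

-- Peels off the last rank instead of the first. This is the shape into which `flip×` turns
-- `ranks (suc c)`, as it exchanges `shiftˡ` and `shiftʳ`.
ranks-last : ∀ c → ranks (suc c) ↭ (c , 0) ∷ map shiftʳ (ranks c)
ranks-last zero = refl
ranks-last (suc c) = ↭-trans (prep _ (↭.map⁺ shiftˡ (ranks-last c)))
  (↭-trans (swap _ _ (↭-reflexive (trans (sym (map-∘ (ranks c))) (map-∘ (ranks c))))) refl)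

ranks-flip : ∀ c → map flip× (ranks c) ↭ ranks c
ranks-flip zero = refl
ranks-flip (suc c) = ↭-trans
  (prep _ (↭-trans (↭-reflexive (trans (sym (map-∘ (ranks c))) (map-∘ (ranks c)))) (↭.map⁺ shiftʳ (ranks-flip c))))
  (↭-sym (ranks-last c))

-- Boolean counts as sums, and the enumeration of signed sequences

countᵇ-∑ : ∀ {A : Set} (p : A → Bool) xs → countᵇ p xs ≡ ∑ xs (χ ∘ p)
countᵇ-∑ p = length-filter (T? ∘ p)

<ᵇ⇒< : ∀ {a b} → T (a <ᵇ b) → a < b
<ᵇ⇒< {a} {b} t = ℤ.suc[i]≤j⇒i<j (subst (_≤ b) (ℤ.+-comm a (+ 1)) (ℤ.≤ᵇ⇒≤ t))

<⇒<ᵇ : ∀ {a b} → a < b → T (a <ᵇ b)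
<⇒<ᵇ {a} {b} a<b = ℤ.≤⇒≤ᵇ (subst (_≤ b) (ℤ.+-comm (+ 1) a) (ℤ.i<j⇒suc[i]≤j a<b))

χ-ι : ∀ {P : Set} {b} (d : Dec P) → (T b → P) → (P → T b) → χ b ≡ ι d
χ-ι {b = b} d = ι-cong (T? b) d

χ-∨ : ∀ a b → (T a → T b → ⊥) → χ (a ∨ b) ≡ χ a + χ b
χ-∨ true true ¬ab with () ← ¬ab _ _
χ-∨ true false _ = refl
χ-∨ false b _ = refl

T-∧⁻ : ∀ {a b} → T (a ∧ b) → T a × T b
T-∧⁻ = Equivalence.to T-∧

T-∧⁺ : ∀ {a b} → T a → T b → T (a ∧ b)
T-∧⁺ ta tb = Equivalence.from T-∧ (ta , tb)

∈-signedVals⁺ : ∀ {n y} → ∣ y ∣ ∈ [ n ] → y ∈ signedVals n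
∈-signedVals⁺ {n} {+ k} k∈ with i , i∈ , refl ← ∈-map⁻ suc k∈ =
  ∈-++⁺ʳ (reverse (map -[1+_] (upTo n))) (∈-map⁺ (λ k → + suc k) i∈)
∈-signedVals⁺ {n} { -[1+ k ]} k∈ with i , i∈ , refl ← ∈-map⁻ suc k∈ =
  ∈-++⁺ˡ (reverse⁺ (∈-map⁺ -[1+_] i∈))

signedVals-unique : ∀ n → Unique (signedVals n)
signedVals-unique n = Unique.++⁺
  (Unique-resp-↭ (↭-sym (↭-reverse _)) (Unique.map⁺ ℤ.-[1+-injective (Unique.upTo⁺ n)))
  (Unique.map⁺ ℤ.+[1+-injective (Unique.upTo⁺ n)) disjoint
  where
  disjoint : ∀ {y} → ¬ (y ∈ reverse (map -[1+_] (upTo n)) × y ∈ map (λ k → + suc k) (upTo n))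
  disjoint (y∈ , y∈′) with _ , _ , refl ← ∈-map⁻ -[1+_] (reverse⁻ {xs = map -[1+_] (upTo n)} y∈) with _ , _ , () ← ∈-map⁻ (λ k → + suc k) y∈′

∈-seqs⁺ : ∀ {n} σ → (∀ {y} → y ∈ σ → y ∈ signedVals n) → σ ∈ seqs n (length σ)
∈-seqs⁺ [] _ = here refl
∈-seqs⁺ (x ∷ σ) σ∈ = ∈-concatMap⁺ (σ∈ (here refl)) (∈-map⁺ (x ∷_) (∈-seqs⁺ σ (σ∈ ∘ there)))

seqs-length : ∀ n m {σ} → σ ∈ seqs n m → length σ ≡ m
seqs-length n zero (here refl) = refl
seqs-length n (suc m) σ∈ with x , _ , σ∈x ← ∈-concatMap⁻ (λ x → map (x ∷_) (seqs n m)) (signedVals n) σ∈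
  with _ , τ∈ , refl ← ∈-map⁻ (x ∷_) σ∈x = cong suc (seqs-length n m τ∈)

seqs-unique : ∀ n m → Unique (seqs n m)
seqs-unique n zero = [] ∷ []
seqs-unique n (suc m) = concatMap-unique (λ σ → at σ 1) (signedVals-unique n)
  (λ _ → Unique.map⁺ ∷-injectiveʳ (seqs-unique n m))
  λ {x} _ σ∈ → first x σ∈
  where
  first : ∀ x {σ} → σ ∈ map (x ∷_) (seqs n m) → at σ 1 ≡ x
  first x σ∈ with _ , _ , refl ← ∈-map⁻ (x ∷_) σ∈ = refl

B-unique : ∀ n → Unique (B n)
B-unique n = Unique.filter⁺ (T? ∘ isTypeB n) (seqs-unique n n)

-- Sums over the positions of a word

positioned : ℕ → List ℤ → List (ℕ × ℤ)
positioned j [] = []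
positioned j (x ∷ s) = (j , x) ∷ positioned (suc j) s

positioned-> : ∀ {k z} j s → (k , z) ∈ positioned (suc j) s → j ℕ.< k
positioned-> j (x ∷ s) (here refl) = ℕ.n<1+n j
positioned-> j (x ∷ s) (there p) = ℕ.<-trans (ℕ.n<1+n j) (positioned-> (suc j) s p)

positioned-∈ : ∀ {k z} j s → (k , z) ∈ positioned j s → z ∈ s
positioned-∈ j (x ∷ s) (here refl) = here refl
positioned-∈ j (x ∷ s) (there p) = there (positioned-∈ (suc j) s p)

map-proj₂-positioned : ∀ j s → map proj₂ (positioned j s) ≡ s
map-proj₂-positioned j [] = refl
map-proj₂-positioned j (x ∷ s) = cong (x ∷_) (map-proj₂-positioned (suc j) s)

∑-positioned : ∀ (f : ℤ → ℕ) j s → ∑ (positioned j s) (f ∘ proj₂) ≡ ∑ s f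
∑-positioned f j s = trans (sym (∑-map f proj₂ (positioned j s))) (cong (λ s → ∑ s f) (map-proj₂-positioned j s))

-- `upTo` is `applyUpTo id`, and passing to its tail composes the function with `suc`; hence the
-- induction needs a general `h` along with a general first position `j`.
∑-applyUpTo-at : ∀ (f : ℕ × ℤ → ℕ) (F h : ℕ → ℕ) j s → (∀ k → F (h k) ≡ f (k + j , at s (suc k))) →
  ∑ (applyUpTo h (length s)) F ≡ ∑ (positioned j s) f
∑-applyUpTo-at f F h j [] _ = refl
∑-applyUpTo-at f F h j (x ∷ s) eq = cong₂ _+_ (eq 0)
  (∑-applyUpTo-at f F (h ∘ suc) (suc j) s λ k → trans (eq (suc k)) (cong (λ i → f (i , at s (suc k))) (sym (ℕ.+-suc k j))))

∑-positions : ∀ {n} (f : ℕ × ℤ → ℕ) (F : ℕ → ℕ) σ → length σ ≡ n →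
  (∀ k → F (suc k) ≡ f (suc k , at σ (suc k))) → ∑ [ n ] F ≡ ∑ (positioned 1 σ) f
∑-positions f F σ refl eq = trans (∑-map F suc (upTo (length σ)))
  (∑-applyUpTo-at f (F ∘ suc) id 1 σ λ k → trans (eq k) (cong (λ i → f (i , at σ (suc k))) (ℕ.+-comm 1 k)))

map-unique-injective : ∀ {A C : Set} (f : A → C) {xs x y} → Unique (map f xs) → x ∈ xs → y ∈ xs → f x ≡ f y → x ≡ y
map-unique-injective f (_ ∷ u) (here refl) (here refl) _ = refl
map-unique-injective f (x∉ ∷ _) (here refl) (there y∈) eq = contradiction eq (All.lookup x∉ (∈-map⁺ f y∈))
map-unique-injective f (x∉ ∷ _) (there x∈) (here refl) eq = contradiction (sym eq) (All.lookup x∉ (∈-map⁺ f x∈))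
map-unique-injective f (_ ∷ u) (there x∈) (there y∈) eq = map-unique-injective f u x∈ y∈ eq

-- States and their mirror symmetry

-- (number of holes, weak excedances, crossings, nestings) of a partial signed permutation
State : Set
State = ℕ × ℕ × ℕ × ℕ

mirror : State → State
mirror (h , a , p , q) = h , a , q , p

choose : ℕ → ℕ → ℕ → ℕ → ℕ → List State
choose c h a p q = map (λ (d , e) → h , a , p + d , q + e) (ranks c)

-- `tailStates` treats the value j and `headStates` the position j. In between, the value has been
-- added but the position has not, so `suc h` values are available for `h` holes. For `h = 0` the
-- default `pred 0` is harmless, because `ranks 0` is empty.
fillState tailStates headStates : State → List State
fillState (h , a , p , q) = choose h (pred h) a p q
tailStates s = s ∷ fillState s
headStates (h , a , p , q) = (suc h , a , p , q) ∷ choose (suc h) h (suc a) p q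

fillStates : ℕ → State → List State
fillStates zero s = s ∷ []
fillStates (suc c) s = concatMap (fillStates c) (fillState s)

-- All holes end up as negative entries, so their number h is kept as the value of neg.
finalStates : State → List State
finalStates (h , s) = map (λ (_ , t) → h , t) (fillStates h (h , s))

states : ℕ → List State
states zero = (0 , 0 , 0 , 0) ∷ []
states (suc m) = concatMap headStates (concatMap tailStates (states m))

-- Equality up to reordering is the right notion, since flipping reverses the list of ranks.
Equivariant : (State → List State) → Set
Equivariant f = ∀ s → f (mirror s) ↭ map mirror (f s)

-- The source of the whole symmetry: the rank of the choice enters only the last two components, so
-- `ranks-flip` exchanges them. All later steps merely transport this.
choose-mirror : ∀ c h a p q → choose c h a q p ↭ map mirror (choose c h a p q)
choose-mirror c h a p q = ↭-trans (↭.map⁺ _ (↭-sym (ranks-flip c)))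
  (↭-reflexive (trans (sym (map-∘ (ranks c))) (map-∘ (ranks c))))

concatMap-mirror : ∀ {f} → Equivariant f → ∀ xs → concatMap f (map mirror xs) ↭ map mirror (concatMap f xs)
concatMap-mirror {f} eq xs = ↭-trans (↭-reflexive (concatMap-map f mirror xs))
  (↭-trans (concatMap-cong-↭ eq xs) (↭-reflexive (sym (map-concatMap mirror f xs))))

concatMap-symmetric : ∀ {f} → Equivariant f → ∀ {xs} → xs ↭ map mirror xs →
  concatMap f xs ↭ map mirror (concatMap f xs)
concatMap-symmetric {f} eq {xs} p = ↭-trans (concatMap-↭ f p) (concatMap-mirror eq xs)

tailStates-equivariant : Equivariant tailStates
tailStates-equivariant (h , a , p , q) = prep _ (choose-mirror h (pred h) a p q)

headStates-equivariant : Equivariant headStates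
headStates-equivariant (h , a , p , q) = prep _ (choose-mirror (suc h) h (suc a) p q)

fillStates-equivariant : ∀ c → Equivariant (fillStates c)
fillStates-equivariant zero s = refl
fillStates-equivariant (suc c) s@(h , a , p , q) = ↭-trans
  (concatMap-↭ (fillStates c) (choose-mirror h (pred h) a p q))
  (concatMap-mirror (fillStates-equivariant c) (fillState s))

finalStates-equivariant : Equivariant finalStates
finalStates-equivariant s@(h , _) = ↭-trans (↭.map⁺ _ (fillStates-equivariant h s))
  (↭-reflexive (trans (sym (map-∘ (fillStates h s))) (map-∘ (fillStates h s))))

states-symmetric : ∀ m → states m ↭ map mirror (states m)
states-symmetric zero = refl
states-symmetric (suc m) = concatMap-symmetric headStates-equivariant
  (concatMap-symmetric tailStates-equivariant (states-symmetric m))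

-- Positive values and ranks in a chain

positives : ℕ → List ℤ
positives n = map +_ [ n ]

<⇒≢ : ∀ {a b : ℤ} → a < b → a ≢ b
<⇒≢ a<b refl = ℤ.<-irrefl refl a<b

∈-positives⁻ : ∀ {n t} → t ∈ positives n → ∃[ k ] k ℕ.< n × t ≡ + suc k
∈-positives⁻ t∈ with j , j∈ , refl ← ∈-map⁻ +_ t∈ with k , k∈ , refl ← ∈-map⁻ suc j∈ = k , ∈-upTo⁻ k∈ , refl

∈-positives⁺ : ∀ {n k} → k ℕ.< n → + suc k ∈ positives n
∈-positives⁺ k<n = ∈-map⁺ +_ (∈-map⁺ suc (∈-upTo⁺ k<n))

positives-< : ∀ n → AllPairs _<_ (positives n)
positives-< n = AllPairs.map⁺ (AllPairs.map⁺ (AllPairs.applyUpTo⁺₁ id n λ i<j _ → +<+ (s≤s i<j)))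

positives-unique : ∀ n → Unique (positives n)
positives-unique n = AllPairs.map <⇒≢ (positives-< n)

rankIn : List ℤ → ℤ → ℕ × ℕ
rankIn L x = ∑ L (λ t → ι (t <? x)) , ∑ L (λ t → ι (x <? t))

∑-one : ∀ {A : Set} (f : A → ℕ) xs → (∀ {x} → x ∈ xs → f x ≡ 1) → ∑ xs f ≡ length xs
∑-one f [] _ = refl
∑-one f (x ∷ xs) eq = cong₂ _+_ (eq (here refl)) (∑-one f xs (eq ∘ there))

-- The least element has nothing below it and adds one smaller element to the rank of each of the
-- others, just as `shiftˡ` does in `ranks`.
chain-ranks : ∀ {L} → AllPairs _<_ L → map (rankIn L) L ≡ ranks (length L)
chain-ranks [] = refl
chain-ranks {t ∷ L} (t< ∷ <L) = cong₂ _∷_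
  (cong₂ _,_
    (cong₂ _+_ (ι-no (t <? t) (ℤ.<-irrefl refl)) (∑-zero L λ {x} x∈ → ι-no (x <? t) (ℤ.<-asym (All.lookup t< x∈))))
    (cong₂ _+_ (ι-no (t <? t) (ℤ.<-irrefl refl)) (∑-one _ L λ {x} x∈ → ι-yes (t <? x) (All.lookup t< x∈))))
  (trans (map-cong-local (All.tabulate λ {x} x∈ → cong₂ _,_
      (cong (_+ _) (ι-yes (t <? x) (All.lookup t< x∈)))
      (cong (_+ _) (ι-no (x <? t) (ℤ.<-asym (All.lookup t< x∈))))))
    (trans (map-∘ L) (cong (map shiftˡ) (chain-ranks <L))))

-- Partial words and their statistics

module PartialWords (n : ℕ) where

  -- A hole is smaller than every value that can still be placed.
  bot : ℤ
  bot = -[1+ n ]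

  vals : List ℤ
  vals = positives n

  bot<+ : ∀ {k} → bot < + k
  bot<+ = -<+

  bot<val : ∀ {t} → t ∈ vals → bot < t
  bot<val t∈ with _ , _ , refl ← ∈-positives⁻ t∈ = -<+

  bot<-val : ∀ {t} → t ∈ vals → bot < - t
  bot<-val t∈ with _ , k<n , refl ← ∈-positives⁻ t∈ = -<- k<n

  val≢bot : ∀ {t} → t ∈ vals → t ≢ bot
  val≢bot t∈ = <⇒≢ (bot<val t∈) ∘ sym

  Free : ℕ → List ℤ → ℤ → Set
  Free j w t = + j ≤ t × t ∉ w

  free? : ∀ j w t → Dec (Free j w t)
  free? j w t = (+ j ≤? t) ×-dec (t ∉? w)

  free : ℕ → List ℤ → List ℤ
  free j w = filter (free? j w) vals

  ∈-free⁻ : ∀ {j w t} → t ∈ free j w → t ∈ vals × + j ≤ t × t ∉ w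
  ∈-free⁻ {j} {w} = ∈-filter⁻ (free? j w) {xs = vals}

  holes : List ℤ → ℕ
  holes w = ∑ w (λ y → ι (y ≟ bot))

  -- Contribution of the entry x at position j followed by the suffix w.  If j ≤ x, the values
  -- t ≥ j missing from w are the ends of upper arcs that start to the left of j; if x < j, the
  -- second sum counts lower arcs.  The other sum is 0 in each case.
  crHead neHead : ℕ → ℤ → List ℤ → ℕ
  crHead j x w = ∑ vals (λ t → ι ((+ j ≤? t) ×-dec (t <? x) ×-dec (t ∉? w)))
               + ∑ w (λ y → ι ((x <? y) ×-dec (y <? + j)))
  neHead j x w = ∑ vals (λ t → ι ((+ j ≤? x) ×-dec (x <? t) ×-dec (t ∉? w)))
               + ∑ w (λ y → ι ((y <? x) ×-dec (x <? + j)))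

  wex cr ne : ℕ → List ℤ → ℕ
  wex j [] = 0
  wex j (x ∷ w) = ι (+ j ≤? x) + wex (suc j) w
  cr j [] = 0
  cr j (x ∷ w) = cr (suc j) w + crHead j x w
  ne j [] = 0
  ne j (x ∷ w) = ne (suc j) w + neHead j x w

  state : ℕ → List ℤ → State
  state j w = holes w , wex j w , cr j w , ne j w

  -- Filling a hole

  data Fills (v : ℤ) : List ℤ → List ℤ → Set where
    here  : ∀ {w} → Fills v (bot ∷ w) (v ∷ w)
    there : ∀ {x w w′} → Fills v w w′ → Fills v (x ∷ w) (x ∷ w′)

  fill : ℤ → List ℤ → List (List ℤ)
  fill v [] = []
  fill v (x ∷ w) with x ≟ bot
  ... | yes _ = (v ∷ w) ∷ map (x ∷_) (fill v w)
  ... | no _ = map (x ∷_) (fill v w)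

  ∈-fill⁻ : ∀ {v w w′} → w′ ∈ fill v w → Fills v w w′
  ∈-fill⁻ {w = x ∷ w} w′∈ with x ≟ bot
  ∈-fill⁻ {w = x ∷ w} (here refl) | yes refl = here
  ∈-fill⁻ {w = x ∷ w} (there w′∈) | yes refl with _ , u∈ , refl ← ∈-map⁻ (x ∷_) w′∈ = there (∈-fill⁻ u∈)
  ∈-fill⁻ {w = x ∷ w} w′∈ | no _ with _ , u∈ , refl ← ∈-map⁻ (x ∷_) w′∈ = there (∈-fill⁻ u∈)

  ∈-fill⁺ : ∀ {v w w′} → Fills v w w′ → w′ ∈ fill v w
  ∈-fill⁺ here with bot ≟ bot
  ... | yes _ = here refl
  ... | no ¬refl = contradiction refl ¬refl
  ∈-fill⁺ (there {x} f) with x ≟ bot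
  ... | yes _ = there (∈-map⁺ (x ∷_) (∈-fill⁺ f))
  ... | no _ = ∈-map⁺ (x ∷_) (∈-fill⁺ f)

  -- A single entry changes, from `bot` to `v`. The lost summand is added on the left to avoid
  -- truncated subtraction.
  fills-∑ : ∀ {v w w′} (f : ℤ → ℕ) → Fills v w w′ → ∑ w′ f + f bot ≡ ∑ w f + f v
  fills-∑ {v} {_ ∷ w} f here = trans (ℕ.+-comm (f v + ∑ w f) _)
    (trans (cong (_+_ (f bot)) (ℕ.+-comm (f v) _)) (sym (ℕ.+-assoc (f bot) _ _)))
  fills-∑ f (there {x} φ) = trans (ℕ.+-assoc (f x) _ _)
    (trans (cong (_+_ (f x)) (fills-∑ f φ)) (sym (ℕ.+-assoc (f x) _ _)))

  fills-holes : ∀ {v w w′} → v ≢ bot → Fills v w w′ → suc (holes w′) ≡ holes w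
  fills-holes {v} {w} {w′} v≢ φ = trans (ℕ.+-comm 1 _)
    (trans (cong (_+_ (holes w′)) (sym (ι-yes (bot ≟ bot) refl)))
    (trans (fills-∑ _ φ) (trans (cong (_+_ (holes w)) (ι-no (v ≟ bot) v≢)) (ℕ.+-identityʳ _))))

  fills-new : ∀ {v w w′} → Fills v w w′ → v ∈ w′
  fills-new here = here refl
  fills-new (there φ) = there (fills-new φ)

  fills-∈⁻ : ∀ {v w w′ t} → Fills v w w′ → t ∈ w′ → t ≡ v ⊎ t ∈ w
  fills-∈⁻ here (here refl) = inj₁ refl
  fills-∈⁻ here (there t∈) = inj₂ (there t∈)
  fills-∈⁻ (there φ) (here refl) = inj₂ (here refl)
  fills-∈⁻ (there φ) (there t∈) = Sum.map₂ there (fills-∈⁻ φ t∈)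

  fills-∈⁺ : ∀ {v w w′ t} → Fills v w w′ → t ≢ bot → t ∈ w → t ∈ w′
  fills-∈⁺ here t≢ (here refl) = contradiction refl t≢
  fills-∈⁺ here t≢ (there t∈) = there t∈
  fills-∈⁺ (there φ) t≢ (here refl) = here refl
  fills-∈⁺ (there φ) t≢ (there t∈) = there (fills-∈⁺ φ t≢ t∈)

  fills-length : ∀ {v w w′} → Fills v w w′ → length w′ ≡ length w
  fills-length here = refl
  fills-length (there φ) = cong suc (fills-length φ)

  erase : ℤ → ℤ → ℤ
  erase v y with y ≟ v
  ... | yes _ = bot
  ... | no _ = y

  erase-self : ∀ v → erase v v ≡ bot
  erase-self v with v ≟ v
  ... | yes _ = refl
  ... | no ¬refl = contradiction refl ¬refl

  erase-≢ : ∀ {v y} → y ≢ v → erase v y ≡ y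
  erase-≢ {v} {y} y≢ with y ≟ v
  ... | yes y≡ = contradiction y≡ y≢
  ... | no _ = refl

  erase-∉ : ∀ {v w} → v ∉ w → map (erase v) w ≡ w
  erase-∉ {w = []} _ = refl
  erase-∉ {w = x ∷ w} v∉ = cong₂ _∷_ (erase-≢ λ { refl → v∉ (here refl) }) (erase-∉ (v∉ ∘ there))

  erase-fills : ∀ {v w w′} → v ∉ w → Fills v w w′ → map (erase v) w′ ≡ w
  erase-fills {v} v∉ here = cong₂ _∷_ (erase-self v) (erase-∉ (v∉ ∘ there))
  erase-fills v∉ (there φ) = cong₂ _∷_ (erase-≢ λ { refl → v∉ (here refl) }) (erase-fills (v∉ ∘ there) φ)

  ∷-unique : ∀ (x : ℤ) {ws} → Unique ws → Unique (map (x ∷_) ws)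
  ∷-unique x = Unique.map⁺ ∷-injectiveʳ

  fill-unique : ∀ {v} w → v ∉ w → Unique (fill v w)
  fill-unique [] _ = []
  fill-unique {v} (x ∷ w) v∉ with x ≟ bot
  ... | yes refl = All.tabulate (λ u∈ eq → new≢ u∈ eq) ∷ ∷-unique x (fill-unique w (v∉ ∘ there))
    where
    new≢ : ∀ {u} → u ∈ map (bot ∷_) (fill v w) → v ∷ w ≢ u
    new≢ u∈ refl with _ , _ , refl ← ∈-map⁻ (bot ∷_) u∈ = v∉ (here refl)
  ... | no _ = ∷-unique x (fill-unique w (v∉ ∘ there))

  -- Covers both kinds of filling: the value j entering a word on the positions from j + 1 on, and,
  -- with `j = 1`, a negative value entering at the end. In both, the new value is below every entry
  -- that is not a hole.
  Low : ℤ → ℕ → List ℤ → Set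
  Low v j w = bot < v × v < + j × (∀ {y} → y ∈ w → y ≡ bot ⊎ v < y)

  module _ {v j x w} (low : Low v j (x ∷ w)) where

    private
      bot<v = proj₁ low
      v<j = proj₁ (proj₂ low)
      above = proj₂ (proj₂ low)

    Low-tail : Low v (suc j) w
    Low-tail = bot<v , ℤ.<-trans v<j (+<+ (ℕ.n<1+n j)) , above ∘ there

    private
      avoids : ∀ {w′ t} → Fills v w w′ → t ∈ vals → + j ≤ t → (t ∉ w → t ∉ w′) × (t ∉ w′ → t ∉ w)
      avoids φ t∈ j≤t =
        (λ t∉ → [ (λ { refl → ℤ.<⇒≱ v<j j≤t }) , t∉ ]′ ∘ fills-∈⁻ φ) ,
        (λ t∉ → t∉ ∘ fills-∈⁺ φ (val≢bot t∈))

    -- Apart from holes every entry is above `v`, so `v` lies between `x` and `j` exactly when `x`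
    -- is a hole. Thus the filled place gains one crossing with each hole on its left.
    crHead-fills : ∀ {w′} → Fills v w w′ → crHead j x w′ ≡ crHead j x w + ι (x ≟ bot)
    crHead-fills {w′} φ = trans (cong₂ _+_ upper lower) (sym (ℕ.+-assoc (∑ vals _) _ _))
      where
      f : ℤ → ℕ
      f y = ι ((x <? y) ×-dec (y <? + j))
      upper = ∑-cong vals λ {t} t∈ → ι-cong ((+ j ≤? t) ×-dec (t <? x) ×-dec (t ∉? w′)) ((+ j ≤? t) ×-dec (t <? x) ×-dec (t ∉? w))
        (λ (j≤t , t<x , t∉) → j≤t , t<x , proj₂ (avoids φ t∈ j≤t) t∉)
        (λ (j≤t , t<x , t∉) → j≤t , t<x , proj₁ (avoids φ t∈ j≤t) t∉)
      f-bot : f bot ≡ 0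
      f-bot = ι-no ((x <? bot) ×-dec (bot <? + j)) λ (x<bot , _) → [ (λ x≡ → <⇒≢ x<bot x≡) , (λ v<x → ℤ.<-asym (ℤ.<-trans bot<v v<x) x<bot) ]′ (above (here refl))
      f-v : f v ≡ ι (x ≟ bot)
      f-v = ι-cong ((x <? v) ×-dec (v <? + j)) (x ≟ bot)
        (λ (x<v , _) → [ id , (λ v<x → contradiction x<v (ℤ.<-asym v<x)) ]′ (above (here refl)))
        λ { refl → bot<v , v<j }
      lower : ∑ w′ f ≡ ∑ w f + ι (x ≟ bot)
      lower = trans (sym (ℕ.+-identityʳ _)) (trans (cong (_+_ (∑ w′ f)) (sym f-bot))
        (trans (fills-∑ f φ) (cong (_+_ (∑ w f)) f-v)))

    -- If `x` is a hole, neither `bot` nor `v` is below it; otherwise both are.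
    neHead-fills : ∀ {w′} → Fills v w w′ → neHead j x w′ ≡ neHead j x w
    neHead-fills {w′} φ = cong₂ _+_ upper lower
      where
      f : ℤ → ℕ
      f y = ι ((y <? x) ×-dec (x <? + j))
      upper = ∑-cong vals λ {t} t∈ → ι-cong ((+ j ≤? x) ×-dec (x <? t) ×-dec (t ∉? w′)) ((+ j ≤? x) ×-dec (x <? t) ×-dec (t ∉? w))
        (λ (j≤x , x<t , t∉) → j≤x , x<t , proj₂ (avoids φ t∈ (ℤ.<⇒≤ (ℤ.≤-<-trans j≤x x<t))) t∉)
        (λ (j≤x , x<t , t∉) → j≤x , x<t , proj₁ (avoids φ t∈ (ℤ.<⇒≤ (ℤ.≤-<-trans j≤x x<t))) t∉)
      f-eq : f bot ≡ f v
      f-eq = ι-cong ((bot <? x) ×-dec (x <? + j)) ((v <? x) ×-dec (x <? + j))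
        (λ (bot<x , x<j) → [ (λ x≡ → contradiction (sym x≡) (<⇒≢ bot<x)) , id ]′ (above (here refl)) , x<j)
        (λ (v<x , x<j) → ℤ.<-trans bot<v v<x , x<j)
      lower : ∑ w′ f ≡ ∑ w f
      lower = ℕ.+-cancelʳ-≡ (f v) _ _ (trans (cong (_+_ (∑ w′ f)) (sym f-eq)) (fills-∑ f φ))

    crHead-low : crHead j v w ≡ crHead j bot w
    crHead-low = cong₂ _+_
      (∑-cong vals λ {t} t∈ → ι-cong ((+ j ≤? t) ×-dec (t <? v) ×-dec (t ∉? w)) ((+ j ≤? t) ×-dec (t <? bot) ×-dec (t ∉? w))
        (λ (j≤t , t<v , _) → contradiction (ℤ.<-≤-trans v<j j≤t) (ℤ.<-asym t<v))
        (λ (j≤t , t<bot , t∉) → j≤t , ℤ.<-trans t<bot bot<v , t∉))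
      (∑-cong w λ {y} y∈ → ι-cong ((v <? y) ×-dec (y <? + j)) ((bot <? y) ×-dec (y <? + j))
        (λ (v<y , y<j) → ℤ.<-trans bot<v v<y , y<j)
        (λ (bot<y , y<j) → [ (λ y≡ → contradiction (sym y≡) (<⇒≢ bot<y)) , id ]′ (above (there y∈)) , y<j))

    -- The holes further right are now below the entry `v`, where they were level with `bot`; each
    -- becomes a nesting. No other entry of `w` is below `v`.
    neHead-low : neHead j v w ≡ neHead j bot w + holes w
    neHead-low = trans (cong₂ _+_
        (∑-cong vals λ {t} t∈ → ι-cong ((+ j ≤? v) ×-dec (v <? t) ×-dec (t ∉? w)) ((+ j ≤? bot) ×-dec (bot <? t) ×-dec (t ∉? w))
          (λ (j≤v , _) → contradiction j≤v (ℤ.<⇒≱ v<j)) λ { (() , _) })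
        (trans (∑-cong w λ {y} y∈ → ι-split ((y <? v) ×-dec (v <? + j)) ((y <? bot) ×-dec (bot <? + j)) (y ≟ bot)
            (λ (y<v , _) → inj₂ ([ id , (λ v<y → contradiction y<v (ℤ.<-asym v<y)) ]′ (above (there y∈))))
            (λ (y<bot , _) → ℤ.<-trans y<bot bot<v , v<j) (λ { refl → bot<v , v<j })
            (λ { ((y<bot , _) , y≡) → <⇒≢ y<bot y≡ }))
          (∑-+ _ (λ y → ι (y ≟ bot)) w)))
      (sym (ℕ.+-assoc (∑ vals _) _ _))

    wexHead-low : ι (+ j ≤? v) ≡ 0
    wexHead-low = ι-no (+ j ≤? v) (ℤ.<⇒≱ v<j)

  +-swapʳ : ∀ a b c → (a + b) + c ≡ (a + c) + b
  +-swapʳ a b c = trans (ℕ.+-assoc a b c) (trans (cong (_+_ a) (ℕ.+-comm b c)) (sym (ℕ.+-assoc a c b)))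

  -- `suc (pred h)` and `h` differ only at `h = 0`, where `ranks h` is empty.
  choose-suc-pred : ∀ (f : ℕ → ℕ × ℕ → State) h → map (f (suc (pred h))) (ranks h) ≡ map (f h) (ranks h)
  choose-suc-pred f zero = refl
  choose-suc-pred f (suc h) = refl

  -- In the resulting rank `(d , e)`, `d` is the number of holes on the left of the filled one and
  -- `e` the number on its right. `fill` runs through the holes from left to right, which is the
  -- order of `ranks`, so the lists agree without reordering.
  fill-states : ∀ {v j} w → Low v j w → map (state j) (fill v w) ≡ fillState (state j w)
  fill-states [] low = refl
  fill-states {v} {j} (x ∷ w) low = goal
    where
    h = holes w ; a = wex (suc j) w ; p = cr (suc j) w ; q = ne (suc j) w
    extend : ℕ → ℕ × ℕ → State
    extend b (d , e) = b + pred h , ι (+ j ≤? x) + a , (p + crHead j x w) + (b + d) , (q + neHead j x w) + e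
    -- The fillings behind the head. A head that is a hole (`b = 1`) stays a hole and adds one
    -- crossing to each of them.
    rest : ∀ b → ι (x ≟ bot) ≡ b → map (state j) (map (x ∷_) (fill v w)) ≡ map (extend b) (ranks h)
    rest b refl = trans (sym (map-∘ (fill v w)))
      (trans (map-cong-local (All.tabulate λ {u} u∈ → cong (λ (c , e) → b + holes u , ι (+ j ≤? x) + wex (suc j) u , cr (suc j) u + c , ne (suc j) u + e)
           (cong₂ _,_ (crHead-fills low (∈-fill⁻ u∈)) (neHead-fills low (∈-fill⁻ u∈)))))
      (trans (map-∘ {g = λ (h , a , p , q) → b + h , ι (+ j ≤? x) + a , p + (crHead j x w + b) , q + neHead j x w} {f = state (suc j)} (fill v w))
      (trans (cong (map _) (fill-states w (Low-tail low)))
      (trans (sym (map-∘ (ranks h)))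
      (map-cong (λ (d , e) → cong₂ (λ c e → b + pred h , ι (+ j ≤? x) + a , c , e)
          (trans (+-swapʳ p d _) (trans (cong (_+ d) (sym (ℕ.+-assoc p _ b))) (ℕ.+-assoc (p + _) b d)))
          (+-swapʳ q e _)) (ranks h))))))
    goal : map (state j) (fill v (x ∷ w)) ≡ fillState (state j (x ∷ w))
    -- Abstracting `rest` together with the test lets the premise on `b` reduce to `refl` in both
    -- branches.
    goal with x ≟ bot | rest
    ... | no _ | r = r 0 refl
    ... | yes refl | r = cong₂ _∷_
      (cong₂ _,_ (cong (_+ h) (ι-no (v ≟ bot) (<⇒≢ (proj₁ low) ∘ sym))) (cong₂ (λ e cn → e + a , cn) (wexHead-low low)
        (cong₂ _,_ (trans (cong (_+_ p) (crHead-low low)) (sym (ℕ.+-identityʳ _)))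
                   (trans (cong (_+_ q) (neHead-low low)) (sym (ℕ.+-assoc q _ h))))))
      (trans (r 1 refl) (trans (choose-suc-pred (λ h (d , e) → h , a , (p + crHead j bot w) + suc d , (q + neHead j bot w) + e) h) (map-∘ (ranks h))))

  -- Extending words by one position

  heads tails : ℕ → List ℤ → List (List ℤ)
  heads j w = map (_∷ w) (bot ∷ free j w)
  tails j w = w ∷ fill (+ j) w

  -- The words on positions j, …, j + m - 1 that arise from σ ∈ B n, where j + m - 1 = n, by
  -- keeping only the values at least j and replacing all other values by holes.
  words : ℕ → ℕ → List (List ℤ)
  words j zero = [] ∷ []
  words j (suc m) = concatMap (heads j) (concatMap (tails j) (words (suc j) m))

  AtLeast : ℕ → List ℤ → Set
  AtLeast j w = ∀ {y} → y ∈ w → y ≡ bot ⊎ (+ j ≤ y × y ∈ vals)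

  ∈-heads⁻ : ∀ {j w u} → u ∈ heads j w → ∃[ x ] u ≡ x ∷ w × (x ≡ bot ⊎ x ∈ free j w)
  ∈-heads⁻ {w = w} u∈ with ∈-map⁻ (_∷ w) u∈
  ... | x , here refl , refl = x , refl , inj₁ refl
  ... | x , there x∈ , refl = x , refl , inj₂ x∈

  ∈-tails⁻ : ∀ {j w u} → u ∈ tails j w → u ≡ w ⊎ Fills (+ j) w u
  ∈-tails⁻ (here refl) = inj₁ refl
  ∈-tails⁻ (there u∈) = inj₂ (∈-fill⁻ u∈)

  module _ {j w} (w≥j : AtLeast j w) where

    crHead-free : ∀ {x} → + j ≤ x → crHead j x w ≡ ∑ (free j w) (λ t → ι (t <? x))
    crHead-free {x} j≤x = trans (cong₂ _+_
      (sym (∑-filter (free? j w) (_<? x) (λ t → (+ j ≤? t) ×-dec (t <? x) ×-dec (t ∉? w)) vals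
        (λ _ (j≤t , t<x , t∉) → (j≤t , t∉) , t<x) (λ (j≤t , t∉) t<x → j≤t , t<x , t∉)))
      (∑-zero w λ {y} _ → ι-no ((x <? y) ×-dec (y <? + j)) λ (x<y , y<j) → ℤ.<⇒≱ (ℤ.<-trans x<y y<j) j≤x))
      (ℕ.+-identityʳ _)

    neHead-free : ∀ {x} → + j ≤ x → neHead j x w ≡ ∑ (free j w) (λ t → ι (x <? t))
    neHead-free {x} j≤x = trans (cong₂ _+_
      (sym (∑-filter (free? j w) (x <?_) (λ t → (+ j ≤? x) ×-dec (x <? t) ×-dec (t ∉? w)) vals
        (λ _ (_ , x<t , t∉) → (ℤ.≤-trans j≤x (ℤ.<⇒≤ x<t) , t∉) , x<t) (λ (_ , t∉) x<t → j≤x , x<t , t∉)))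
      (∑-zero w λ {y} _ → ι-no ((y <? x) ×-dec (x <? + j)) λ (_ , x<j) → ℤ.<⇒≱ x<j j≤x))
      (ℕ.+-identityʳ _)

    crHead-bot : crHead j bot w ≡ 0
    crHead-bot = cong₂ _+_
      (∑-zero vals λ {t} t∈ → ι-no ((+ j ≤? t) ×-dec (t <? bot) ×-dec (t ∉? w)) λ (_ , t<bot , _) → ℤ.<-asym t<bot (bot<val t∈))
      (∑-zero w λ {y} y∈ → ι-no ((bot <? y) ×-dec (y <? + j)) λ (bot<y , y<j) →
        [ (λ y≡ → <⇒≢ bot<y (sym y≡)) , (λ (j≤y , _) → ℤ.<⇒≱ y<j j≤y) ]′ (w≥j y∈))

    neHead-bot : neHead j bot w ≡ 0
    neHead-bot = cong₂ _+_
      (∑-zero vals λ {t} t∈ → ι-no ((+ j ≤? bot) ×-dec (bot <? t) ×-dec (t ∉? w)) λ { (() , _) })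
      (∑-zero w λ {y} y∈ → ι-no ((y <? bot) ×-dec (bot <? + j)) λ (y<bot , _) →
        [ <⇒≢ y<bot , (λ (j≤y , _) → ℤ.<⇒≱ (ℤ.<-trans y<bot (bot<+ {j})) j≤y) ]′ (w≥j y∈))

    -- A free value has as its rank among the free values the numbers of upper arcs it crosses and
    -- is nested in. A new hole adds nothing yet: all entries on its right are holes or at least
    -- `j`, so its lower pairs arise only through later fillings.
    head-states : length (free j w) ≡ suc (holes w) → map (state j) (heads j w) ≡ headStates (state (suc j) w)
    head-states len = cong₂ _∷_
      (cong₂ _,_ (cong (_+ h) (ι-yes (bot ≟ bot) refl))
        (cong₂ (λ c e → a , c , e) (trans (cong (_+_ p) crHead-bot) (ℕ.+-identityʳ _))
                                  (trans (cong (_+_ q) neHead-bot) (ℕ.+-identityʳ _))))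
      (trans (sym (map-∘ (free j w)))
      (trans (map-cong-local (All.tabulate at-free))
      (trans (map-∘ {g = extend} {f = rankIn (free j w)} (free j w))
      (cong (map extend) (trans (chain-ranks (AllPairs.filter⁺ (free? j w) (positives-< n))) (cong ranks len))))))
      where
      h = holes w ; a = wex (suc j) w ; p = cr (suc j) w ; q = ne (suc j) w
      extend : ℕ × ℕ → State
      extend (d , e) = h , suc a , p + d , q + e
      at-free : ∀ {x} → x ∈ free j w → state j (x ∷ w) ≡ extend (rankIn (free j w) x)
      at-free {x} x∈ with x∈v , j≤x , _ ← ∈-free⁻ {j} {w} x∈ =
        cong₂ _,_ (cong (_+ h) (ι-no (x ≟ bot) (val≢bot x∈v)))
        (cong₂ _,_ (cong (_+ a) (ι-yes (+ j ≤? x) j≤x))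
        (cong₂ _,_ (cong (_+_ p) (crHead-free j≤x)) (cong (_+_ q) (neHead-free j≤x))))

  -- Balance between free values and holes

  length-free : ∀ j w → length (free j w) ≡ ∑ vals (ι ∘ free? j w)
  length-free j w = length-filter (free? j w) vals

  free-suc : ∀ {j w} → + j ∈ vals → + j ∉ w → length (free j w) ≡ suc (length (free (suc j) w))
  free-suc {j} {w} j∈ j∉ = trans (length-free j w)
    (trans (∑-cong vals λ {t} _ → ι-split (free? j w t) (t ≟ + j) (free? (suc j) w t)
      (λ (j≤t , t∉) → split j≤t t∉) (λ { refl → ℤ.≤-refl , j∉ })
      (λ (j<t , t∉) → ℤ.≤-trans (+≤+ (ℕ.n≤1+n j)) j<t , t∉)
      λ { (refl , +≤+ j<j , _) → ℕ.<-irrefl refl j<j })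
    (trans (∑-+ (λ t → ι (t ≟ + j)) _ vals)
    (cong₂ _+_ (∑-unique-∈ _≟_ (positives-unique n) j∈) (sym (length-free (suc j) w)))))
    where
    split : ∀ {t} → + j ≤ t → t ∉ w → t ≡ + j ⊎ Free (suc j) w t
    split (+≤+ {n = k} j≤k) t∉ with j ℕ.≟ k
    ... | yes refl = inj₁ refl
    ... | no j≢k = inj₂ (+≤+ (ℕ.≤∧≢⇒< j≤k j≢k) , t∉)

  free-fills : ∀ {j w w′} → Fills (+ j) w w′ → length (free j w′) ≡ length (free (suc j) w)
  free-fills {j} {w} {w′} φ = trans (length-free j w′) (trans (∑-cong vals λ {t} t∈ →
    ι-cong (free? j w′ t) (free? (suc j) w t)
      (λ (j≤t , t∉) → strict j≤t (λ { refl → t∉ (fills-new φ) }) , t∉ ∘ fills-∈⁺ φ (val≢bot t∈))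
      (λ (j<t , t∉) → ℤ.≤-trans (+≤+ (ℕ.n≤1+n j)) j<t , [ (λ { refl → ℤ.<-irrefl refl (weaken j<t) }) , t∉ ]′ ∘ fills-∈⁻ φ))
    (sym (length-free (suc j) w)))
    where
    strict : ∀ {t} → + j ≤ t → + j ≢ t → + suc j ≤ t
    strict (+≤+ j≤k) j≢k = +≤+ (ℕ.≤∧≢⇒< j≤k (j≢k ∘ cong (λ k → + k)))
    weaken : ∀ {t} → + suc j ≤ t → + j < t
    weaken (+≤+ j<k) = +<+ j<k

  free-bot : ∀ j w → length (free j (bot ∷ w)) ≡ length (free j w)
  free-bot j w = trans (length-free j (bot ∷ w)) (trans (∑-cong vals λ {t} t∈ →
    ι-cong (free? j (bot ∷ w) t) (free? j w t)
      (λ (j≤t , t∉) → j≤t , t∉ ∘ there)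
      (λ (j≤t , t∉) → j≤t , λ { (here refl) → val≢bot t∈ refl ; (there t∈w) → t∉ t∈w }))
    (sym (length-free j w)))

  free-∷ : ∀ {j x w} → x ∈ free j w → length (free j w) ≡ suc (length (free j (x ∷ w)))
  free-∷ {j} {x} {w} x∈f with x∈ , j≤x , x∉ ← ∈-free⁻ {j} {w} x∈f = trans (length-free j w)
    (trans (∑-cong vals λ {t} _ → ι-split (free? j w t) (t ≟ x) (free? j (x ∷ w) t)
      (λ (j≤t , t∉) → split j≤t t∉ (t ≟ x)) (λ { refl → j≤x , x∉ })
      (λ (j≤t , t∉) → j≤t , t∉ ∘ there) λ { (refl , _ , t∉) → t∉ (here refl) })
    (trans (∑-+ (λ t → ι (t ≟ x)) _ vals)
    (cong₂ _+_ (∑-unique-∈ _≟_ (positives-unique n) x∈) (sym (length-free j (x ∷ w))))))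
    where
    split : ∀ {t} → + j ≤ t → t ∉ w → Dec (t ≡ x) → t ≡ x ⊎ Free j (x ∷ w) t
    split j≤t t∉ (yes t≡x) = inj₁ t≡x
    split j≤t t∉ (no t≢x) = inj₂ (j≤t , λ { (here t≡x) → t≢x t≡x ; (there t∈) → t∉ t∈ })

  -- There are as many positions from j to n as values, so `balanced` says that the entries other
  -- than holes do not repeat.
  record Word (j m : ℕ) (w : List ℤ) : Set where
    constructor word
    field
      size : length w ≡ m
      atLeast : AtLeast j w
      balanced : length (free j w) ≡ holes w

  -- The intermediate stage: the value j already counts as free or is placed, but position j is
  -- still absent, whence the surplus of one.
  record Tail (j m : ℕ) (w : List ℤ) : Set where
    constructor tail
    field
      size : length w ≡ m
      atLeast : AtLeast j w
      balanced : length (free j w) ≡ suc (holes w)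

  open Word public
  open Tail public

  position∈vals : ∀ {j m} → suc j + suc m ≡ suc n → + suc j ∈ vals
  position∈vals {j} {m} eq = ∈-positives⁺ (ℕ.≤-trans (s≤s (ℕ.m≤m+n j m)) (ℕ.≤-reflexive (trans (sym (ℕ.+-suc j m)) (ℕ.suc-injective eq))))

  next : ∀ {j m} → j + suc m ≡ suc n → suc j + m ≡ suc n
  next {j} {m} = trans (sym (ℕ.+-suc j m))

  word-avoids : ∀ {j m w} → Word (suc j) m w → + j ∉ w
  word-avoids W j∈ with atLeast W j∈
  ... | inj₁ ()
  ... | inj₂ (+≤+ j<j , _) = ℕ.<-irrefl refl j<j

  weaken : ∀ {j w} → AtLeast (suc j) w → AtLeast j w
  weaken {j} w≥ y∈ = Sum.map₂ (λ (j<y , y∈) → ℤ.≤-trans (+≤+ (ℕ.n≤1+n j)) j<y , y∈) (w≥ y∈)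

  tails-tail : ∀ {j m w u} → + j ∈ vals → Word (suc j) m w → u ∈ tails j w → Tail j m u
  tails-tail {j} {w = w} j∈ W@(word sz w≥ bal) u∈ with ∈-tails⁻ u∈
  ... | inj₁ refl = tail sz (weaken w≥) (trans (free-suc j∈ (word-avoids W)) (cong suc bal))
  ... | inj₂ φ = tail (trans (fills-length φ) sz)
    ([ (λ { refl → inj₂ (ℤ.≤-refl , j∈) }) , weaken w≥ ]′ ∘ fills-∈⁻ φ)
    (trans (free-fills φ) (trans bal (sym (fills-holes (λ ()) φ))))

  heads-word : ∀ {j m w u} → Tail j m w → u ∈ heads j w → Word j (suc m) u
  heads-word {j} {w = w} (tail sz w≥ bal) u∈ with ∈-heads⁻ {j} {w} u∈
  ... | _ , refl , inj₁ refl = word (cong suc sz)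
    (λ { (here refl) → inj₁ refl ; (there y∈) → w≥ y∈ })
    (trans (free-bot j w) (trans bal (cong (_+ holes w) (sym (ι-yes (bot ≟ bot) refl)))))
  ... | x , refl , inj₂ x∈f = let x∈ , j≤x , _ = ∈-free⁻ {j} {w} x∈f in word (cong suc sz)
    (λ { (here refl) → inj₂ (j≤x , x∈) ; (there y∈) → w≥ y∈ })
    (trans (ℕ.suc-injective (trans (sym (free-∷ {j} x∈f)) bal)) (cong (_+ holes w) (sym (ι-no (x ≟ bot) (val≢bot x∈)))))

  -- Invariants, distinctness and states of the enumerated words

  words-word : ∀ {j} m {w} → suc j + m ≡ suc n → w ∈ words (suc j) m → Word (suc j) m w
  tails-of-words : ∀ {j} m {w} → suc j + suc m ≡ suc n → w ∈ concatMap (tails (suc j)) (words (suc (suc j)) m) → Tail (suc j) m w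

  words-word {j} zero eq (here refl) = word refl (λ ())
    (trans (length-free (suc j) []) (∑-zero vals λ {t} t∈ → ι-no (free? (suc j) [] t) (too-big t∈)))
    where
    -- With no position left, `suc j` equals `suc n` and exceeds every value.
    too-big : ∀ {t} → t ∈ vals → ¬ Free (suc j) [] t
    too-big t∈ (j≤t , _) with k , k<n , refl ← ∈-positives⁻ t∈ | +≤+ (s≤s j≤k) ← j≤t =
      ℕ.<⇒≱ k<n (ℕ.≤-trans (ℕ.≤-reflexive (sym (ℕ.suc-injective (trans (sym (ℕ.+-identityʳ _)) eq)))) j≤k)
  words-word (suc m) eq w∈ with u , u∈ , w∈u ← ∈-concatMap⁻ _ _ w∈ = heads-word (tails-of-words m eq u∈) w∈u

  tails-of-words {j} m eq w∈ with u , u∈ , w∈u ← ∈-concatMap⁻ _ _ w∈ =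
    tails-tail (position∈vals eq) (words-word m (next {suc j} eq) u∈) w∈u

  -- Each half of a step can be undone: `drop 1` removes the entry at position j, and erasing the
  -- value j reopens the hole that it may have filled.
  words-unique : ∀ {j} m → suc j + m ≡ suc n → Unique (words (suc j) m)
  words-unique zero _ = [] ∷ []
  words-unique {j} (suc m) eq = concatMap-unique (drop 1)
    (concatMap-unique (map (erase (+ suc j))) (words-unique m (next {suc j} eq)) tails-unique tails-erase)
    heads-unique heads-drop
    where
    word-of : ∀ {w} → w ∈ words (suc (suc j)) m → Word (suc (suc j)) m w
    word-of = words-word m (next {suc j} eq)
    tails-unique : ∀ {w} → w ∈ words (suc (suc j)) m → Unique (tails (suc j) w)
    tails-unique {w} w∈ = All.tabulate (λ { u∈ refl → word-avoids (word-of w∈) (fills-new (∈-fill⁻ {w = w} u∈)) })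
      ∷ fill-unique w (word-avoids (word-of w∈))
    tails-erase : ∀ {w u} → w ∈ words (suc (suc j)) m → u ∈ tails (suc j) w → map (erase (+ suc j)) u ≡ w
    tails-erase w∈ u∈ with ∈-tails⁻ u∈
    ... | inj₁ refl = erase-∉ (word-avoids (word-of w∈))
    ... | inj₂ φ = erase-fills (word-avoids (word-of w∈)) φ
    heads-unique : ∀ {w} → w ∈ concatMap (tails (suc j)) (words (suc (suc j)) m) → Unique (heads (suc j) w)
    heads-unique {w} _ = Unique.map⁺ ∷-injectiveˡ
      (All.tabulate (λ { x∈ refl → val≢bot (proj₁ (∈-free⁻ {suc j} {w} x∈)) refl })
      ∷ Unique.filter⁺ (free? (suc j) w) (positives-unique n))
    heads-drop : ∀ {w u} → w ∈ concatMap (tails (suc j)) (words (suc (suc j)) m) → u ∈ heads (suc j) w → drop 1 u ≡ w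
    heads-drop {w} _ u∈ with _ , refl , _ ← ∈-heads⁻ {suc j} {w} u∈ = refl

  -- The states of the extensions of a word depend only on the state of that word, so the
  -- enumeration of words projects entry by entry onto the recursion `states`.
  words-states : ∀ {j} m → suc j + m ≡ suc n → map (state (suc j)) (words (suc j) m) ≡ states m
  words-states zero _ = refl
  words-states {j} (suc m) eq = trans
    (map-concatMap-local (state (suc j)) (state (suc (suc j))) (heads (suc j)) headStates _ λ w∈ →
      let T = tails-of-words m eq w∈ in head-states (atLeast T) (balanced T))
    (cong (concatMap headStates) (trans
      (map-concatMap-local (state (suc (suc j))) (state (suc (suc j))) (tails (suc j)) tailStates _ λ {w} w∈ →
        cong (state (suc (suc j)) w ∷_) (fill-states w (low (words-word m (next {suc j} eq) w∈))))
      (cong (concatMap tailStates) (words-states m (next {suc j} eq)))))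
    where
    low : ∀ {w} → Word (suc (suc j)) m w → Low (+ suc j) (suc (suc j)) w
    low W = -<+ , +<+ ℕ.≤-refl , λ y∈ → Sum.map₂ (λ { (+≤+ j<y , _) → +<+ j<y }) (atLeast W y∈)

  -- Filling the last holes with negative values

  fillAll : List ℤ → List ℤ → List (List ℤ)
  fillAll [] w = w ∷ []
  fillAll (c ∷ cs) w = concatMap (fillAll cs) (fill (- c) w)

  completions : List ℤ → List (List ℤ)
  completions w = fillAll (free 1 w) w

  data Completes : List ℤ → List ℤ → List ℤ → Set where
    []  : ∀ {w} → Completes [] w w
    _∷_ : ∀ {c cs w w′ σ} → Fills (- c) w w′ → Completes cs w′ σ → Completes (c ∷ cs) w σ

  ∈-fillAll⁻ : ∀ cs {w σ} → σ ∈ fillAll cs w → Completes cs w σ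
  ∈-fillAll⁻ [] (here refl) = []
  ∈-fillAll⁻ (c ∷ cs) σ∈ with u , u∈ , σ∈u ← ∈-concatMap⁻ _ _ σ∈ = ∈-fill⁻ u∈ ∷ ∈-fillAll⁻ cs σ∈u

  ∈-fillAll⁺ : ∀ {cs w σ} → Completes cs w σ → σ ∈ fillAll cs w
  ∈-fillAll⁺ [] = here refl
  ∈-fillAll⁺ (φ ∷ ψ) = ∈-concatMap⁺ (∈-fill⁺ φ) (∈-fillAll⁺ ψ)

  All-vals : List ℤ → Set
  All-vals cs = ∀ {c} → c ∈ cs → c ∈ vals

  -val<0 : ∀ {c} → c ∈ vals → - c < + 0
  -val<0 c∈ with _ , _ , refl ← ∈-positives⁻ c∈ = -<+

  -val≢bot : ∀ {c} → c ∈ vals → - c ≢ bot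
  -val≢bot c∈ = <⇒≢ (bot<-val c∈) ∘ sym

  -- Increasing `cs` have decreasing negatives, so each new value is below all entries that are not
  -- holes and `fill-states` applies again in every round.
  fillAll-states : ∀ cs w → All-vals cs → AllPairs _<_ cs →
    (∀ {c y} → c ∈ cs → y ∈ w → y ≡ bot ⊎ - c < y) →
    map (state 1) (fillAll cs w) ≡ fillStates (length cs) (state 1 w)
  fillAll-states [] w _ _ _ = refl
  fillAll-states (c ∷ cs) w cs∈ (c< ∷ cs<) above = trans
    (map-concatMap-local (state 1) (state 1) (fillAll cs) (fillStates (length cs)) (fill (- c) w) λ u∈ →
      fillAll-states cs _ (cs∈ ∘ there) cs< λ c′∈ y∈ →
        [ (λ { refl → inj₂ (ℤ.neg-mono-< (All.lookup c< c′∈)) }) , above (there c′∈) ]′ (fills-∈⁻ (∈-fill⁻ {w = w} u∈) y∈))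
    (cong (concatMap (fillStates (length cs)))
      (fill-states w (bot<-val (cs∈ (here refl)) , ℤ.<-trans (-val<0 (cs∈ (here refl))) (+<+ (s≤s z≤n)) , above (here refl))))

  completes-length : ∀ {cs w σ} → Completes cs w σ → length σ ≡ length w
  completes-length [] = refl
  completes-length (φ ∷ ψ) = trans (completes-length ψ) (fills-length φ)

  completes-holes : ∀ {cs w σ} → All-vals cs → Completes cs w σ → length cs + holes σ ≡ holes w
  completes-holes _ [] = refl
  completes-holes cs∈ (φ ∷ ψ) = trans (cong suc (completes-holes (cs∈ ∘ there) ψ)) (fills-holes (-val≢bot (cs∈ (here refl))) φ)

  completes-old : ∀ {cs w σ t} → Completes cs w σ → t ≢ bot → t ∈ w → t ∈ σ
  completes-old [] _ t∈ = t∈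
  completes-old (φ ∷ ψ) t≢ t∈ = completes-old ψ t≢ (fills-∈⁺ φ t≢ t∈)

  completes-new : ∀ {cs w σ c} → All-vals cs → Completes cs w σ → c ∈ cs → - c ∈ σ
  completes-new cs∈ (φ ∷ ψ) (here refl) = completes-old ψ (-val≢bot (cs∈ (here refl))) (fills-new φ)
  completes-new cs∈ (φ ∷ ψ) (there c∈) = completes-new (cs∈ ∘ there) ψ c∈

  completes-∈⁻ : ∀ {cs w σ y} → Completes cs w σ → y ∈ σ → y ∈ w ⊎ ∃[ c ] c ∈ cs × y ≡ - c
  completes-∈⁻ [] y∈ = inj₁ y∈
  completes-∈⁻ (φ ∷ ψ) y∈ with completes-∈⁻ ψ y∈
  ... | inj₂ (c , c∈ , eq) = inj₂ (c , there c∈ , eq)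
  ... | inj₁ y∈w′ with fills-∈⁻ φ y∈w′
  ...   | inj₁ eq = inj₂ (_ , here refl , eq)
  ...   | inj₂ y∈w = inj₁ y∈w

  negatives : List ℤ → ℕ
  negatives w = ∑ w (λ y → ι (y <? + 0))

  -- `bot` is itself negative, so a hole counts as a negative entry before and after it is filled.
  completes-negatives : ∀ {cs w σ} → All-vals cs → Completes cs w σ → negatives σ ≡ negatives w
  completes-negatives _ [] = refl
  completes-negatives {c ∷ _} {w} cs∈ (_∷_ {w′ = w′} φ ψ) = trans (completes-negatives (cs∈ ∘ there) ψ)
    (ℕ.+-cancelʳ-≡ 1 _ _ (trans (fills-∑ (λ y → ι (y <? + 0)) φ) (cong (_+_ (negatives w)) (ι-yes (- c <? + 0) (-val<0 (cs∈ (here refl)))))))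

  -- Recovering the word from a completion

  restrict : ℕ → ℤ → ℤ
  restrict j y with + j ≤? y
  ... | yes _ = y
  ... | no _ = bot

  restrict-≥ : ∀ {j y} → + j ≤ y → restrict j y ≡ y
  restrict-≥ {j} {y} j≤y with + j ≤? y
  ... | yes _ = refl
  ... | no j≰y = contradiction j≤y j≰y

  restrict-< : ∀ {j y} → y < + j → restrict j y ≡ bot
  restrict-< {j} {y} y<j with + j ≤? y
  ... | yes j≤y = contradiction j≤y (ℤ.<⇒≱ y<j)
  ... | no _ = refl

  restrict-value : ∀ j y → restrict j y ≡ y ⊎ restrict j y ≡ bot
  restrict-value j y with + j ≤? y
  ... | yes _ = inj₁ refl
  ... | no _ = inj₂ refl

  restrict-neg : ∀ {c} → c ∈ vals → restrict 1 (- c) ≡ bot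
  restrict-neg c∈ = restrict-< (ℤ.<-trans (-val<0 c∈) (+<+ (s≤s z≤n)))

  restrict-fills : ∀ {c w w′} → c ∈ vals → Fills (- c) w w′ → map (restrict 1) w′ ≡ map (restrict 1) w
  restrict-fills {w = _ ∷ w} c∈ here = cong (_∷ map (restrict 1) w) (trans (restrict-neg c∈) (sym (restrict-< (bot<+ {1}))))
  restrict-fills c∈ (there {x} φ) = cong (restrict 1 x ∷_) (restrict-fills c∈ φ)

  restrict-completes : ∀ {cs w σ} → All-vals cs → AtLeast 1 w → Completes cs w σ → map (restrict 1) σ ≡ w
  restrict-completes {w = w} cs∈ w≥ ψ = trans (collapse cs∈ ψ) (map-id-local (All.tabulate λ y∈ →
    [ (λ { refl → restrict-< (bot<+ {1}) }) , (λ (1≤y , _) → restrict-≥ 1≤y) ]′ (w≥ y∈)))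
    where
    collapse : ∀ {cs w σ} → All-vals cs → Completes cs w σ → map (restrict 1) σ ≡ map (restrict 1) w
    collapse _ [] = refl
    collapse cs∈ (φ ∷ ψ) = trans (collapse (cs∈ ∘ there) ψ) (restrict-fills (cs∈ (here refl)) φ)

  -- Undoes the rounds of `fillAll`, the last one first, and so separates the completions that
  -- branch at different holes.
  eraseAll : List ℤ → List ℤ → List ℤ
  eraseAll [] σ = σ
  eraseAll (c ∷ cs) σ = map (erase (- c)) (eraseAll cs σ)

  fills-avoid : ∀ {c c′ w w′} → c ≢ c′ → Fills (- c) w w′ → - c′ ∉ w → - c′ ∉ w′
  fills-avoid c≢ φ c′∉ = [ (λ eq → c≢ (sym (ℤ.neg-injective eq))) , c′∉ ]′ ∘ fills-∈⁻ φ

  eraseAll-completes : ∀ {cs w σ} → Unique cs → (∀ {c} → c ∈ cs → - c ∉ w) → Completes cs w σ → eraseAll cs σ ≡ w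
  eraseAll-completes _ _ [] = refl
  eraseAll-completes (c∉ ∷ u) ∉w (φ ∷ ψ) = trans
    (cong (map (erase _)) (eraseAll-completes u (λ c∈ → fills-avoid (All.lookup c∉ c∈) φ (∉w (there c∈))) ψ))
    (erase-fills (∉w (here refl)) φ)

  fillAll-unique : ∀ cs w → Unique cs → (∀ {c} → c ∈ cs → - c ∉ w) → Unique (fillAll cs w)
  fillAll-unique [] w _ _ = [] ∷ []
  fillAll-unique (c ∷ cs) w (c∉ ∷ u) ∉w = concatMap-unique (eraseAll cs) (fill-unique w (∉w (here refl)))
    (λ {x} x∈ → fillAll-unique cs x u (avoid x∈))
    (λ x∈ σ∈ → eraseAll-completes u (avoid x∈) (∈-fillAll⁻ cs σ∈))
    where
    avoid : ∀ {x} → x ∈ fill (- c) w → ∀ {c′} → c′ ∈ cs → - c′ ∉ x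
    avoid x∈ c′∈ = fills-avoid (All.lookup c∉ c′∈) (∈-fill⁻ x∈) (∉w (there c′∈))

  free-vals : ∀ w → All-vals (free 1 w)
  free-vals w = proj₁ ∘ ∈-free⁻ {1} {w}

  all-completions : List (List ℤ)
  all-completions = concatMap completions (words 1 n)

  AtLeast-neg : ∀ {w c} → AtLeast 1 w → c ∈ vals → - c ∉ w
  AtLeast-neg w≥ c∈ -c∈ with w≥ -c∈
  ... | inj₁ eq = -val≢bot c∈ eq
  ... | inj₂ (1≤ , _) = ℤ.<⇒≱ (ℤ.<-trans (-val<0 c∈) (+<+ (s≤s z≤n))) 1≤

  all-completions-unique : Unique all-completions
  all-completions-unique = concatMap-unique (map (restrict 1)) (words-unique n refl)
    (λ {w} w∈ → fillAll-unique (free 1 w) w (Unique.filter⁺ (free? 1 w) (positives-unique n))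
      λ c∈ → AtLeast-neg (atLeast (words-word n refl w∈)) (free-vals w c∈))
    (λ {w} w∈ σ∈ → restrict-completes (free-vals w) (atLeast (words-word n refl w∈)) (∈-fillAll⁻ (free 1 w) σ∈))

  -- Completions are exactly the signed permutations

  record Signed (σ : List ℤ) : Set where
    constructor signed
    field
      size : length σ ≡ n
      range : ∀ {y} → y ∈ σ → ∣ y ∣ ∈ [ n ]
      onto : ∀ {t} → t ∈ [ n ] → t ∈ map ∣_∣ σ

  ∣val∣ : ∀ {t} → t ∈ vals → ∣ t ∣ ∈ [ n ]
  ∣val∣ t∈ with _ , j∈ , refl ← ∈-map⁻ (λ k → + k) t∈ = j∈

  completion-signed : ∀ {w σ} → w ∈ words 1 n → σ ∈ completions w → Signed σ
  completion-signed {w} {σ} w∈ σ∈ = signed (trans (completes-length ψ) (Word.size W)) range onto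
    where
    W = words-word n refl w∈
    ψ = ∈-fillAll⁻ (free 1 w) σ∈
    -- Each free value closes one hole, and by `balanced` there are equally many of both.
    no-holes : holes σ ≡ 0
    no-holes = ℕ.+-cancelˡ-≡ (length (free 1 w)) _ _
      (trans (completes-holes (free-vals w) ψ) (trans (sym (Word.balanced W)) (sym (ℕ.+-identityʳ _))))
    bot∉ : ∀ {s} → holes s ≡ 0 → bot ∉ s
    bot∉ {_ ∷ s} eq (here refl) with () ← trans (sym (cong (_+ holes s) (ι-yes (bot ≟ bot) refl))) eq
    bot∉ {x ∷ s} eq (there b∈) = bot∉ (ℕ.m+n≡0⇒n≡0 (ι (x ≟ bot)) eq) b∈
    range : ∀ {y} → y ∈ σ → ∣ y ∣ ∈ [ n ]
    range y∈ with completes-∈⁻ ψ y∈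
    ... | inj₂ (c , c∈ , refl) = subst (_∈ [ n ]) (sym (ℤ.∣-i∣≡∣i∣ c)) (∣val∣ (free-vals w c∈))
    ... | inj₁ y∈w with Word.atLeast W y∈w
    ...   | inj₁ refl = contradiction y∈ (bot∉ no-holes)
    ...   | inj₂ (_ , y∈v) = ∣val∣ y∈v
    onto : ∀ {t} → t ∈ [ n ] → t ∈ map ∣_∣ σ
    onto {t} t∈ with t∈v ← ∈-map⁺ (λ k → + k) t∈ | + t ∈? w
    ... | yes t∈w = ∈-map⁺ ∣_∣ (completes-old ψ (λ ()) t∈w)
    ... | no t∉w = subst (_∈ map ∣_∣ σ) (ℤ.∣-i∣≡∣i∣ (+ t)) (∈-map⁺ ∣_∣ (completes-new (free-vals w) ψ
      (∈-filter⁺ (free? 1 w) t∈v (1≤val t∈v , t∉w))))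
      where
      1≤val : ∀ {t} → t ∈ vals → + 1 ≤ t
      1≤val t∈ with _ , _ , refl ← ∈-positives⁻ t∈ = +≤+ (s≤s z≤n)

  -- Two images of a list that differ only at the single occurrence of `v` are one filling apart.
  -- This serves the positive values in `restrict-words` and the negative ones in `map-completes`.
  map-fills : ∀ {v s} (f g : ℤ → ℤ) → Unique s → v ∈ s → f v ≡ bot → g v ≡ v →
    (∀ {y} → y ∈ s → y ≢ v → f y ≡ g y) → Fills v (map f s) (map g s)
  map-fills {v} {_ ∷ s} f g (v∉ ∷ _) (here refl) fv gv eq = subst₂ (Fills v)
    (cong₂ _∷_ (sym fv) (map-cong-local (All.tabulate λ y∈ → sym (eq (there y∈) λ { refl → All.lookup v∉ y∈ refl }))))
    (cong (_∷ map g s) (sym gv)) here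
  map-fills {v} {x ∷ s} f g (x∉ ∷ u) (there v∈) fv gv eq =
    subst (λ y → Fills v (y ∷ map f s) (g x ∷ map g s)) (sym (eq (here refl) (All.lookup x∉ v∈)))
      (there (map-fills f g u v∈ fv gv (eq ∘ there)))

  restrict-words : ∀ {j} m s → suc j + m ≡ suc n → length s ≡ m → Unique s →
    (∀ {y} → y ∈ s → + 1 ≤ y → y ∈ vals) → map (restrict (suc j)) s ∈ words (suc j) m
  restrict-words zero [] _ _ _ _ = here refl
  restrict-words {j} (suc m) (x ∷ s) eq len (x∉ ∷ u) s∈ = ∈-concatMap⁺ (∈-concatMap⁺
      (restrict-words m s (next {suc j} eq) (ℕ.suc-injective len) u (s∈ ∘ there)) in-tails) in-heads
    where
    r = restrict (suc j)
    r′ = restrict (suc (suc j))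
    -- The thresholds `suc j` and `suc (suc j)` disagree only on the value `suc j`; hence the tail
    -- is unchanged or has one more hole filled.
    agree : ∀ {y} → y ≢ + suc j → r′ y ≡ r y
    agree {y} y≢ with ℤ.<-cmp y (+ suc j)
    ... | tri< y<j _ _ = trans (restrict-< (ℤ.<-trans y<j (+<+ (ℕ.n<1+n _)))) (sym (restrict-< y<j))
    ... | tri≈ _ y≡ _ = contradiction y≡ y≢
    ... | tri> _ _ (+<+ j<y) = trans (restrict-≥ (+≤+ j<y)) (sym (restrict-≥ (+≤+ (ℕ.<⇒≤ j<y))))
    in-tails : map r s ∈ tails (suc j) (map r′ s)
    in-tails with + suc j ∈? s
    ... | yes j∈ = there (∈-fill⁺ (map-fills r′ r u j∈ (restrict-< (+<+ (ℕ.n<1+n _))) (restrict-≥ ℤ.≤-refl) λ {y} _ → agree {y}))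
    ... | no j∉ = here (map-cong-local (All.tabulate λ {y} y∈ → sym (agree {y} λ { refl → j∉ y∈ })))
    in-heads : r x ∷ map r s ∈ heads (suc j) (map r s)
    in-heads with + suc j ≤? x
    ... | no _ = here refl
    ... | yes j≤x = there (∈-map⁺ (_∷ map r s) (∈-filter⁺ (free? (suc j) (map r s)) x∈ (j≤x , fresh)))
      where
      x∈ = s∈ (here refl) (ℤ.≤-trans (+≤+ (s≤s z≤n)) j≤x)
      fresh : x ∉ map r s
      fresh x∈r with y , y∈ , eq ← ∈-map⁻ r x∈r =
        [ (λ ry≡y → All.lookup x∉ y∈ (trans eq ry≡y)) , (λ ry≡bot → val≢bot x∈ (trans eq ry≡bot)) ]′ (restrict-value (suc j) y)

  restore : (ℤ → ℤ) → ℤ → ℤ → ℤ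
  restore f v y with y ≟ v
  ... | yes _ = y
  ... | no _ = f y

  restore-self : ∀ f v → restore f v v ≡ v
  restore-self f v with v ≟ v
  ... | yes _ = refl
  ... | no ¬refl = contradiction refl ¬refl

  restore-≢ : ∀ f {v y} → y ≢ v → f y ≡ restore f v y
  restore-≢ f {v} {y} y≢ with y ≟ v
  ... | yes y≡ = contradiction y≡ y≢
  ... | no _ = refl

  -- Generalized from `restrict 1` to any `f` that hides just the values still to be filled in. Each
  -- round passes from `f` to `restore f (- c)`, until the map is the identity on `σ`.
  map-completes : ∀ cs (f : ℤ → ℤ) {σ} → Unique σ → Unique cs → (∀ {c} → c ∈ cs → - c ∈ σ) →
    (∀ {c} → c ∈ cs → f (- c) ≡ bot) → (∀ {y} → y ∈ σ → (∀ {c} → c ∈ cs → y ≢ - c) → f y ≡ y) →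
    Completes cs (map f σ) σ
  map-completes [] f {σ} _ _ _ _ fix = subst (λ w → Completes [] w σ)
    (sym (map-id-local (All.tabulate λ y∈ → fix y∈ λ ()))) []
  map-completes (c ∷ cs) f uσ (c∉ ∷ u) cs∈ f-bot fix =
    map-fills f g uσ (cs∈ (here refl)) (f-bot (here refl)) (restore-self f (- c)) (λ _ → restore-≢ f)
    ∷ map-completes cs g uσ u (cs∈ ∘ there)
        (λ c′∈ → trans (sym (restore-≢ f λ eq → All.lookup c∉ c′∈ (sym (ℤ.neg-injective eq)))) (f-bot (there c′∈)))
        g-fix
    where
    g = restore f (- c)
    g-fix : ∀ {y} → y ∈ _ → (∀ {c} → c ∈ cs → y ≢ - c) → g y ≡ y
    g-fix {y} y∈ ∉cs with y ≟ - c
    ... | yes _ = refl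
    ... | no y≢ = fix y∈ λ { (here refl) → y≢ ; (there c∈) → ∉cs c∈ }

  [n]-unique : Unique [ n ]
  [n]-unique = Unique.map⁺ ℕ.suc-injective (Unique.upTo⁺ n)

  module _ {σ : List ℤ} (S : Signed σ) where

    -- A list of length `n` that covers `[ n ]` has no room for repetitions.
    abs-↭ : map ∣_∣ σ ↭ [ n ]
    abs-↭ = ⊆-length⇒↭ [n]-unique (Signed.onto S)
      (trans (trans (length-map suc (upTo n)) (length-upTo n)) (sym (trans (length-map ∣_∣ σ) (Signed.size S))))

    abs-unique : Unique (map ∣_∣ σ)
    abs-unique = Unique-resp-↭ (↭-sym abs-↭) [n]-unique

    abs-injective : ∀ {x y} → x ∈ σ → y ∈ σ → ∣ x ∣ ≡ ∣ y ∣ → x ≡ y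
    abs-injective = map-unique-injective ∣_∣ abs-unique

    signed-unique : Unique σ
    signed-unique = Unique.map⁻ abs-unique

    signed-vals : ∀ {y} → y ∈ σ → + 1 ≤ y → y ∈ vals
    signed-vals {+ k} y∈ _ = ∈-map⁺ (λ k → + k) (Signed.range S y∈)

    signed-completion : σ ∈ all-completions
    signed-completion = ∈-concatMap⁺ w∈ (∈-fillAll⁺ (map-completes (free 1 w) (restrict 1) signed-unique
      (Unique.filter⁺ (free? 1 w) (positives-unique n)) negative∈ (restrict-neg ∘ free-vals w) kept))
      where
      w = map (restrict 1) σ
      w∈ : w ∈ words 1 n
      w∈ = restrict-words n σ refl (Signed.size S) signed-unique signed-vals
      -- `c` occurs in `σ` up to sign; a positive occurrence would have survived in `w`.
      negative∈ : ∀ {c} → c ∈ free 1 w → - c ∈ σ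
      negative∈ {c} c∈ with c∈v , 1≤c , c∉ ← ∈-free⁻ {1} {w} c∈
        with _ , _ , refl ← ∈-positives⁻ c∈v | ∈-map⁻ ∣_∣ (Signed.onto S (∣val∣ c∈v))
      ... | + _ , y∈ , refl = contradiction (subst (_∈ w) (restrict-≥ 1≤c) (∈-map⁺ (restrict 1) y∈)) c∉
      ... | -[1+ _ ] , y∈ , refl = y∈
      kept : ∀ {y} → y ∈ σ → (∀ {c} → c ∈ free 1 w → y ≢ - c) → restrict 1 y ≡ y
      kept {+ suc k} _ _ = restrict-≥ (+≤+ (s≤s z≤n))
      kept {+ zero} y∈ _ with _ , _ , () ← ∈-map⁻ suc (Signed.range S y∈)
      kept { -[1+ k ]} y∈ ∉free = contradiction refl
        (∉free (∈-filter⁺ (free? 1 w) (∈-map⁺ (λ k → + k) (Signed.range S y∈)) (+≤+ (s≤s z≤n) , fresh)))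
        where
        fresh : + suc k ∉ w
        fresh k∈ with z , z∈ , eq ← ∈-map⁻ (restrict 1) k∈ with restrict-value 1 z
        ... | inj₁ r≡z with refl ← trans eq r≡z with () ← abs-injective y∈ z∈ refl
        ... | inj₂ r≡bot with () ← trans eq r≡bot

    -- From pairs of positions to sums over suffixes

    -- The positive values missing from the suffix s are those taken before position j, together
    -- with the absolute values of the negative entries.
    module _ {Q : ℤ → Set} (Q? : ∀ t → Dec (Q t)) (Q-pos : ∀ {t} → Q t → + 0 < t) where

      ∑-missing : ∀ P j y s → positioned 1 σ ≡ P ++ (j , y) ∷ positioned (suc j) s →
        (∀ {i x} → (i , x) ∈ P → i ℕ.< j × x ∉ s) → ¬ Q y →
        ∑ (positioned 1 σ) (λ (i , x) → ι ((i ℕ.<? j) ×-dec Q? x) + ι (Q? (- x)))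
          ≡ ∑ vals (λ t → ι (Q? t ×-dec (t ∉? s)))
      ∑-missing P j y s split before ¬Qy = trans
        -- The entry `x` is matched with the value `∣ x ∣`; by `abs-↭` the sum over entries becomes
        -- a sum over all values.
        (∑-cong (positioned 1 σ) λ {(i , x)} p∈ → pointwise i x (positioned-∈ 1 σ p∈) (location i x p∈))
        (trans (∑-positioned (λ x → F (+ ∣ x ∣)) 1 σ)
        (trans (sym (∑-map (λ k → F (+ k)) ∣_∣ σ))
        (trans (∑-↭ (λ k → F (+ k)) abs-↭) (sym (∑-map F (λ k → + k) [ n ])))))
        where
        F : ℤ → ℕ
        F t = ι (Q? t ×-dec (t ∉? s))
        s⊆σ : ∀ {z} → z ∈ s → z ∈ σ
        s⊆σ {z} z∈ with (k , _) , p∈ , refl ← ∈-map⁻ proj₂ (subst (z ∈_) (sym (map-proj₂-positioned (suc j) s)) z∈) =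
          positioned-∈ 1 σ (subst ((k , z) ∈_) (sym split) (∈-++⁺ʳ P (there p∈)))
        -- The entry at `j` itself is neither before `j` nor among the positions of `s`; `¬ Q y`
        -- keeps it out of the count of missing values.
        location : ∀ i x → (i , x) ∈ positioned 1 σ → (i ℕ.< j × x ∉ s) ⊎ (¬ i ℕ.< j × (¬ Q x ⊎ x ∈ s))
        location i x p∈ with ∈-++⁻ P (subst ((i , x) ∈_) split p∈)
        ... | inj₁ p = inj₁ (before p)
        ... | inj₂ (here refl) = inj₂ (ℕ.<-irrefl refl , inj₁ ¬Qy)
        ... | inj₂ (there p) = inj₂ (ℕ.<-asym (positioned-> j s p) , inj₂ (positioned-∈ (suc j) s p))
        ¬Q-neg : ∀ k → ¬ Q (- + k)
        ¬Q-neg zero q = ℤ.<-irrefl refl (Q-pos q)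
        ¬Q-neg (suc k) q with () ← Q-pos q
        pointwise : ∀ i x → x ∈ σ → (i ℕ.< j × x ∉ s) ⊎ (¬ i ℕ.< j × (¬ Q x ⊎ x ∈ s)) →
          ι ((i ℕ.<? j) ×-dec Q? x) + ι (Q? (- x)) ≡ F (+ ∣ x ∣)
        pointwise i (+ k) _ loc = trans (cong (_+_ (ι ((i ℕ.<? j) ×-dec Q? (+ k)))) (ι-no (Q? (- + k)) (¬Q-neg k)))
          (trans (ℕ.+-identityʳ _) (ι-cong ((i ℕ.<? j) ×-dec Q? (+ k)) (Q? (+ k) ×-dec (+ k ∉? s)) (to loc) (from loc)))
          where
          to : _ → i ℕ.< j × Q (+ k) → Q (+ k) × + k ∉ s
          to (inj₁ (_ , x∉)) (_ , q) = q , x∉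
          to (inj₂ (i≮j , _)) (i<j , _) = contradiction i<j i≮j
          from : _ → Q (+ k) × + k ∉ s → i ℕ.< j × Q (+ k)
          from (inj₁ (i<j , _)) (q , _) = i<j , q
          from (inj₂ (_ , inj₁ ¬q)) (q , _) = contradiction q ¬q
          from (inj₂ (_ , inj₂ x∈)) (_ , x∉) = contradiction x∈ x∉
        -- A negative entry uses up its absolute value, so `- x` cannot occur in `s`.
        pointwise i -[1+ k ] x∈ _ = trans (cong (_+ ι (Q? (+ suc k))) (ι-no ((i ℕ.<? j) ×-dec Q? -[1+ k ]) λ (_ , q) → neg-absurd (Q-pos q)))
          (ι-cong (Q? (+ suc k)) (Q? (+ suc k) ×-dec (+ suc k ∉? s)) (λ q → q , λ k∈ → opposite (abs-injective x∈ (s⊆σ k∈) refl)) proj₁)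
          where
          neg-absurd : ¬ + 0 < -[1+ k ]
          neg-absurd ()
          opposite : -[1+ k ] ≢ + suc k
          opposite ()

    module _ {Q R : ℕ → ℤ → ℤ → Set} (Q? : ∀ j y t → Dec (Q j y t)) (R? : ∀ j y t → Dec (R j y t))
      (Q-pos : ∀ {j y t} → Q (suc j) y t → + 0 < t) (Q-irrefl : ∀ {j y} → ¬ Q j y y) where

      -- Upper pairs are charged to the second arc, lower pairs to the first. In this way the
      -- partner of a lower pair lies in the suffix, while that of an upper pair shows up as a
      -- missing value.
      pairStat : ℕ × ℤ → ℕ × ℤ → ℕ
      pairStat (i , x) (j , y) =
        (ι ((i ℕ.<? j) ×-dec Q? j y x) + ι (Q? j y (- x))) + ι (R? i x y ×-dec (i ℕ.<? j))

      suffixStat : ℕ → ℤ → List ℤ → ℕ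
      suffixStat j y s = ∑ vals (λ t → ι (Q? j y t ×-dec (t ∉? s))) + ∑ s (λ z → ι (R? j y z))

      ∑-later : ∀ P j y s → positioned 1 σ ≡ P ++ (j , y) ∷ positioned (suc j) s →
        (∀ {i x} → (i , x) ∈ P → i ℕ.< j × x ∉ s) →
        ∑ (positioned 1 σ) (λ (k , z) → ι (R? j y z ×-dec (j ℕ.<? k))) ≡ ∑ s (λ z → ι (R? j y z))
      ∑-later P j y s split before = trans (cong (λ p → ∑ p f) split)
        (trans (∑-++ f P _)
        (cong₂ _+_
          (∑-zero P λ {(k , z)} p∈ → ι-no (R? j y z ×-dec (j ℕ.<? k)) λ (_ , j<k) → ℕ.<-asym j<k (proj₁ (before p∈)))
          (cong₂ _+_ (ι-no (R? j y y ×-dec (j ℕ.<? j)) λ (_ , j<j) → ℕ.<-irrefl refl j<j)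
            (trans (∑-cong (positioned (suc j) s) λ {(k , z)} p∈ →
                ι-cong (R? j y z ×-dec (j ℕ.<? k)) (R? j y z) proj₁ (_, positioned-> j s p∈))
              (∑-positioned (λ z → ι (R? j y z)) (suc j) s)))))
        where
        f : ℕ × ℤ → ℕ
        f (k , z) = ι (R? j y z ×-dec (j ℕ.<? k))

      -- Exchanging the two summations in the upper part only gathers at each position all pairs
      -- charged to it; `∑-missing` and `∑-later` then evaluate the two parts.
      ∑-pairStat : ∀ (st : ℕ → List ℤ → ℕ) → (∀ j → st j [] ≡ 0) →
        (∀ j y s → st j (y ∷ s) ≡ st (suc j) s + suffixStat j y s) →
        ∑ (positioned 1 σ) (λ a → ∑ (positioned 1 σ) (pairStat a)) ≡ st 1 σ
      ∑-pairStat st st-[] st-∷ = trans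
        (trans (∑-cong p λ {a} _ → ∑-+ (U a) (L a) p)
        (trans (∑-+ (λ a → ∑ p (U a)) (λ a → ∑ p (L a)) p)
        (trans (cong (_+ ∑ p (λ a → ∑ p (L a))) (∑-swap U p p))
        (sym (∑-+ (λ b → ∑ p (λ a → U a b)) (λ b → ∑ p (L b)) p)))))
        (suffixes [] 0 σ refl signed-unique (λ ()))
        where
        p = positioned 1 σ
        U L : ℕ × ℤ → ℕ × ℤ → ℕ
        U (i , x) (j , y) = ι ((i ℕ.<? j) ×-dec Q? j y x) + ι (Q? j y (- x))
        L (i , x) (j , y) = ι (R? i x y ×-dec (i ℕ.<? j))
        suffixes : ∀ P j s → p ≡ P ++ positioned (suc j) s → Unique s →
          (∀ {i x} → (i , x) ∈ P → i ℕ.< suc j × x ∉ s) →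
          ∑ (positioned (suc j) s) (λ b → ∑ p (λ a → U a b) + ∑ p (L b)) ≡ st (suc j) s
        suffixes P j [] _ _ _ = sym (st-[] (suc j))
        suffixes P j (y ∷ s) split (y∉ ∷ u) before = trans
          (ℕ.+-comm (∑ p (λ a → U a (suc j , y)) + ∑ p (L (suc j , y))) _)
          (trans (cong₂ _+_
            (suffixes (P ++ (suc j , y) ∷ []) (suc j) s (trans split (sym (++-assoc P _ _))) u before′)
            (cong₂ _+_ (∑-missing (Q? (suc j) y) Q-pos P (suc j) y s split before″ Q-irrefl)
                       (∑-later P (suc j) y s split before″)))
          (sym (st-∷ (suc j) y s)))
          where
          before″ : ∀ {i x} → (i , x) ∈ P → i ℕ.< suc j × x ∉ s
          before″ p∈ = proj₁ (before p∈) , proj₂ (before p∈) ∘ there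
          before′ : ∀ {i x} → (i , x) ∈ P ++ (suc j , y) ∷ [] → i ℕ.< suc (suc j) × x ∉ s
          before′ q∈ with ∈-++⁻ P q∈
          ... | inj₁ p∈ = ℕ.m<n⇒m<1+n (proj₁ (before″ p∈)) , proj₂ (before″ p∈)
          ... | inj₂ (here refl) = ℕ.n<1+n _ , λ y∈ → All.lookup y∉ y∈ refl

  -- The list `B n` as a rearrangement of the completions

  B⇒signed : ∀ {σ} → σ ∈ B n → Signed σ
  B⇒signed {σ} σ∈ with σ∈s , t ← ∈-filter⁻ (T? ∘ isTypeB n) {xs = seqs n n} σ∈ with t₁ , t₂ ← T-∧⁻ t = signed
    (seqs-length n n σ∈s)
    (λ y∈ → Any.map toWitness (any⁻ _ [ n ] (All.lookup (all⁺ _ σ t₁) y∈)))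
    (λ {t} t∈ → onto (any⁻ _ σ (All.lookup (all⁺ _ [ n ] t₂) t∈)))
    where
    onto : ∀ {t} → Any (λ x → T (∣ x ∣ ==ℕ t)) σ → t ∈ map ∣_∣ σ
    onto p with x , x∈ , e ← find p with refl ← toWitness e = ∈-map⁺ ∣_∣ x∈

  signed⇒B : ∀ {σ} → Signed σ → σ ∈ B n
  signed⇒B {σ} (signed size range onto) = ∈-filter⁺ (T? ∘ isTypeB n)
    (subst (λ m → σ ∈ seqs n m) size (∈-seqs⁺ σ (∈-signedVals⁺ ∘ range)))
    (T-∧⁺ (all⁻ _ (All.tabulate λ y∈ → any⁺ _ (Any.map fromWitness (range y∈))))
          (all⁻ _ (All.tabulate λ t∈ → any⁺ _ (hit (onto t∈)))))
    where
    hit : ∀ {t} → t ∈ map ∣_∣ σ → Any (λ x → T (∣ x ∣ ==ℕ t)) σ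
    hit t∈ with x , x∈ , refl ← ∈-map⁻ ∣_∣ t∈ = lose x∈ (fromWitness refl)

  B-↭ : B n ↭ all-completions
  B-↭ = unique∧set⇒↭ all-completions-unique (B-unique n)
    (λ σ∈ → let w , w∈ , σ∈w = ∈-concatMap⁻ completions (words 1 n) σ∈ in signed⇒B (completion-signed w∈ σ∈w))
    (signed-completion ∘ B⇒signed)

  -- Agreement with the defined statistics

  crUpper? neUpper? : ∀ j y t → Dec _
  crUpper? j y t = (+ j ≤? t) ×-dec (t <? y)
  neUpper? j y t = (+ j ≤? y) ×-dec (y <? t)
  crLower? neLower? : ∀ j y z → Dec _
  crLower? j y z = (y <? z) ×-dec (z <? + j)
  neLower? j y z = (z <? y) ×-dec (y <? + j)

  module _ {σ} (S : Signed σ) where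

    private
      p = positioned 1 σ

    neg-negatives : neg σ ≡ negatives σ
    neg-negatives = trans (countᵇ-∑ _ σ) (∑-cong σ λ {y} _ → χ-ι (y <? + 0) <ᵇ⇒< <⇒<ᵇ)

    wexB-wex : wexB n σ ≡ wex 1 σ
    wexB-wex = trans (countᵇ-∑ _ [ n ])
      (trans (∑-positions (λ (j , y) → ι (+ j ≤? y)) _ σ (Signed.size S) λ k → χ-ι (+ suc k ≤? at σ (suc k)) ℤ.≤ᵇ⇒≤ ℤ.≤⇒≤ᵇ)
        (collect 1 σ))
      where
      collect : ∀ j s → ∑ (positioned j s) (λ (j , y) → ι (+ j ≤? y)) ≡ wex j s
      collect j [] = refl
      collect j (y ∷ s) = cong (_+_ _) (collect (suc j) s)

    ∑-pairs : (b : ℕ × ℕ → Bool) (f : ℕ × ℤ → ℕ × ℤ → ℕ) →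
      (∀ k l → χ (b (suc k , suc l)) ≡ f (suc k , at σ (suc k)) (suc l , at σ (suc l))) →
      countᵇ b (pairs n) ≡ ∑ p (λ a → ∑ p (f a))
    ∑-pairs b f eq = trans (countᵇ-∑ b (pairs n))
      (trans (∑-concatMap (χ ∘ b) (λ i → map (i ,_) [ n ]) [ n ])
      (∑-positions (λ a → ∑ p (f a)) (λ i → ∑ (map (i ,_) [ n ]) (χ ∘ b)) σ (Signed.size S) λ k →
        trans (∑-map (χ ∘ b) (suc k ,_) [ n ])
          (∑-positions (f (suc k , at σ (suc k))) _ σ (Signed.size S) (eq k))))

    -- For positive i and j the three cases of a crossing or nesting exclude each other.
    private
      three : ∀ a b c → (T a → T b → ⊥) → (T a → T c → ⊥) → (T b → T c → ⊥) → χ (a ∨ b ∨ c) ≡ (χ a + χ b) + χ c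
      three a b c ab ac bc = trans (χ-∨ a (b ∨ c) (either b c ab ac)) (trans (cong (_+_ (χ a)) (χ-∨ b c bc)) (sym (ℕ.+-assoc (χ a) _ _)))
        where
        either : ∀ b c → (T a → T b → ⊥) → (T a → T c → ⊥) → T a → T (b ∨ c) → ⊥
        either true c ab _ ta _ = ab ta _
        either false c _ ac ta tc = ac ta tc

      conj3⁻ : ∀ a b c d e f → T ((a <ᵇ b) ∧ (c ≤ᵇ d) ∧ (e <ᵇ f)) → a < b × c ≤ d × e < f
      conj3⁻ a b c d e f t with t₁ , t₂₃ ← T-∧⁻ {a <ᵇ b} t with t₂ , t₃ ← T-∧⁻ {c ≤ᵇ d} t₂₃ = <ᵇ⇒< {a} t₁ , ℤ.≤ᵇ⇒≤ t₂ , <ᵇ⇒< {e} t₃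

      conj3⁺ : ∀ a b c d e f → a < b → c ≤ d → e < f → T ((a <ᵇ b) ∧ (c ≤ᵇ d) ∧ (e <ᵇ f))
      conj3⁺ a b c d e f p q r = T-∧⁺ (<⇒<ᵇ p) (T-∧⁺ (ℤ.≤⇒≤ᵇ q) (<⇒<ᵇ r))

      lower⁻ : ∀ a b c d e f → T ((a <ᵇ b) ∧ (c <ᵇ d) ∧ (e <ᵇ f)) → a < b × c < d × e < f
      lower⁻ a b c d e f t with t₁ , t₂₃ ← T-∧⁻ {a <ᵇ b} t with t₂ , t₃ ← T-∧⁻ {c <ᵇ d} t₂₃ = <ᵇ⇒< {a} t₁ , <ᵇ⇒< {c} t₂ , <ᵇ⇒< {e} t₃

      lower⁺ : ∀ a b c d e f → a < b → c < d → e < f → T ((a <ᵇ b) ∧ (c <ᵇ d) ∧ (e <ᵇ f))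
      lower⁺ a b c d e f p q r = T-∧⁺ (<⇒<ᵇ p) (T-∧⁺ (<⇒<ᵇ q) (<⇒<ᵇ r))

      positive-neg : ∀ {x} → + 0 < x → + 0 < - x → ⊥
      positive-neg {+ zero} (+<+ ()) _
      positive-neg {+ suc _} _ ()
      positive-neg { -[1+ _ ]} () _

      0<suc : ∀ {l x} → + suc l ≤ x → + 0 < x
      0<suc = ℤ.<-≤-trans (+<+ (s≤s z≤n))

    croB-cr : croB n σ ≡ cr 1 σ
    croB-cr = trans
      (∑-pairs (isCrossing σ) (pairStat S crUpper? crLower? crUpper-positive crUpper-irrefl) λ k l →
        cases k l (at σ (suc k)) (at σ (suc l)))
      (∑-pairStat S crUpper? crLower? crUpper-positive crUpper-irrefl cr (λ _ → refl) head)
      where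
      crUpper-positive : ∀ {j y t} → + suc j ≤ t × t < y → + 0 < t
      crUpper-positive (j≤t , _) = 0<suc j≤t
      crUpper-irrefl : ∀ {j y} → ¬ (+ j ≤ y × y < y)
      crUpper-irrefl (_ , y<y) = ℤ.<-irrefl refl y<y
      head : ∀ j y s → _
      head j y s = cong (λ u → cr (suc j) s + (u + _)) (∑-cong vals λ {t} _ →
        ι-cong ((+ j ≤? t) ×-dec (t <? y) ×-dec (t ∉? s)) (crUpper? j y t ×-dec (t ∉? s))
          (λ (a , b , c) → (a , b) , c) (λ ((a , b) , c) → a , b , c))
      cases : ∀ k l x y → let I = + suc k ; J = + suc l in
        χ (((I <ᵇ J) ∧ (J ≤ᵇ x) ∧ (x <ᵇ y)) ∨ ((- I <ᵇ J) ∧ (J ≤ᵇ - x) ∧ (- x <ᵇ y)) ∨ ((x <ᵇ y) ∧ (y <ᵇ I) ∧ (I <ᵇ J)))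
        ≡ _
      cases k l x y = trans
        (three ((+ suc k <ᵇ + suc l) ∧ (+ suc l ≤ᵇ x) ∧ (x <ᵇ y)) ((- + suc k <ᵇ + suc l) ∧ (+ suc l ≤ᵇ - x) ∧ (- x <ᵇ y)) ((x <ᵇ y) ∧ (y <ᵇ + suc k) ∧ (+ suc k <ᵇ + suc l))
          -- The two upper cases would make `x` and `- x` both positive; an upper case forces
          -- `j < y`, whereas the lower case forces `y < i < j`.
          (λ a b → let _ , j≤x , _ = a⁻ a ; _ , j≤-x , _ = b⁻ b in positive-neg (0<suc j≤x) (0<suc j≤-x))
          (λ a c → let i<j , j≤x , x<y = a⁻ a ; _ , y<i , _ = c⁻ c in
            ℤ.<-asym y<i (ℤ.<-trans i<j (ℤ.≤-<-trans j≤x x<y)))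
          (λ b c → let _ , j≤-x , -x<y = b⁻ b ; _ , y<i , i<j = c⁻ c in
            ℤ.<-asym (ℤ.≤-<-trans j≤-x -x<y) (ℤ.<-trans y<i i<j)))
        (cong₂ _+_ (cong₂ _+_
          (χ-ι ((suc k ℕ.<? suc l) ×-dec crUpper? (suc l) y x)
            (λ a → let i<j , j≤x , x<y = a⁻ a in ℤ.drop‿+<+ i<j , j≤x , x<y)
            (λ (i<j , j≤x , x<y) → a⁺ (+<+ i<j) j≤x x<y))
          -- A negative start is left of every positive position, so `-<+` supplies the first
          -- comparison.
          (χ-ι (crUpper? (suc l) y (- x)) (proj₂ ∘ b⁻) (λ (j≤-x , -x<y) → b⁺ -<+ j≤-x -x<y)))
          (χ-ι (crLower? (suc k) x y ×-dec (suc k ℕ.<? suc l))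
            (λ c → let x<y , y<i , i<j = c⁻ c in (x<y , y<i) , ℤ.drop‿+<+ i<j)
            (λ ((x<y , y<i) , i<j) → c⁺ x<y y<i (+<+ i<j))))
        where
        I′ = + suc k
        J′ = + suc l
        a⁻ = conj3⁻ I′ J′ J′ x x y
        a⁺ = conj3⁺ I′ J′ J′ x x y
        b⁻ = conj3⁻ (- I′) J′ J′ (- x) (- x) y
        b⁺ = conj3⁺ (- I′) J′ J′ (- x) (- x) y
        c⁻ = lower⁻ x y y I′ I′ J′
        c⁺ = lower⁺ x y y I′ I′ J′

    nesB-ne : nesB n σ ≡ ne 1 σ
    nesB-ne = trans
      (∑-pairs (isNesting σ) (pairStat S neUpper? neLower? neUpper-positive neUpper-irrefl) λ k l →
        cases k l (at σ (suc k)) (at σ (suc l)))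
      (∑-pairStat S neUpper? neLower? neUpper-positive neUpper-irrefl ne (λ _ → refl) head)
      where
      neUpper-positive : ∀ {j y t} → + suc j ≤ y × y < t → + 0 < t
      neUpper-positive (j≤y , y<t) = ℤ.<-trans (0<suc j≤y) y<t
      neUpper-irrefl : ∀ {j y} → ¬ (+ j ≤ y × y < y)
      neUpper-irrefl (_ , y<y) = ℤ.<-irrefl refl y<y
      head : ∀ j y s → _
      head j y s = cong (λ u → ne (suc j) s + (u + _)) (∑-cong vals λ {t} _ →
        ι-cong ((+ j ≤? y) ×-dec (y <? t) ×-dec (t ∉? s)) (neUpper? j y t ×-dec (t ∉? s))
          (λ (a , b , c) → (a , b) , c) (λ ((a , b) , c) → a , b , c))
      cases : ∀ k l x y → let I = + suc k ; J = + suc l in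
        χ (((I <ᵇ J) ∧ (J ≤ᵇ y) ∧ (y <ᵇ x)) ∨ ((- I <ᵇ J) ∧ (J ≤ᵇ y) ∧ (y <ᵇ - x)) ∨ ((y <ᵇ x) ∧ (x <ᵇ I) ∧ (I <ᵇ J)))
        ≡ _
      cases k l x y = trans
        (three ((+ suc k <ᵇ + suc l) ∧ (+ suc l ≤ᵇ y) ∧ (y <ᵇ x)) ((- + suc k <ᵇ + suc l) ∧ (+ suc l ≤ᵇ y) ∧ (y <ᵇ - x)) ((y <ᵇ x) ∧ (x <ᵇ + suc k) ∧ (+ suc k <ᵇ + suc l))
          (λ a b → let _ , j≤y , y<x = a⁻ a ; _ , _ , y<-x = b⁻ b in
            positive-neg (ℤ.<-trans (0<suc j≤y) y<x) (ℤ.<-trans (0<suc j≤y) y<-x))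
          (λ a c → let i<j , j≤y , y<x = a⁻ a ; _ , x<i , _ = c⁻ c in
            ℤ.<-asym x<i (ℤ.<-trans i<j (ℤ.≤-<-trans j≤y y<x)))
          (λ b c → let _ , j≤y , _ = b⁻ b ; y<x , x<i , i<j = c⁻ c in
            ℤ.<⇒≱ (ℤ.<-trans y<x (ℤ.<-trans x<i i<j)) j≤y))
        (cong₂ _+_ (cong₂ _+_
          (χ-ι ((suc k ℕ.<? suc l) ×-dec neUpper? (suc l) y x)
            (λ a → let i<j , j≤y , y<x = a⁻ a in ℤ.drop‿+<+ i<j , j≤y , y<x)
            (λ (i<j , j≤y , y<x) → a⁺ (+<+ i<j) j≤y y<x))
          (χ-ι (neUpper? (suc l) y (- x)) (proj₂ ∘ b⁻) (λ (j≤y , y<-x) → b⁺ -<+ j≤y y<-x)))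
          (χ-ι (neLower? (suc k) x y ×-dec (suc k ℕ.<? suc l))
            (λ c → let y<x , x<i , i<j = c⁻ c in (y<x , x<i) , ℤ.drop‿+<+ i<j)
            (λ ((y<x , x<i) , i<j) → c⁺ y<x x<i (+<+ i<j))))
        where
        I′ = + suc k
        J′ = + suc l
        a⁻ = conj3⁻ I′ J′ J′ y y x
        a⁺ = conj3⁺ I′ J′ J′ y y x
        b⁻ = conj3⁻ (- I′) J′ J′ y y (- x)
        b⁺ = conj3⁺ (- I′) J′ J′ y y (- x)
        c⁻ = lower⁻ y x x I′ I′ J′
        c⁺ = lower⁺ y x x I′ I′ J′

  -- The joint distribution and its symmetry

  statistics : List ℤ → State
  statistics σ = neg σ , wexB n σ , croB n σ , nesB n σ

  completions-statistics : ∀ {w} → w ∈ words 1 n → map statistics (completions w) ≡ finalStates (state 1 w)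
  completions-statistics {w} w∈ = trans
    (map-cong-local (All.tabulate λ σ∈ → agree (completion-signed w∈ σ∈) (∈-fillAll⁻ (free 1 w) σ∈)))
    -- A completion has no holes left, so the first component of `state 1` is replaced by the number
    -- of holes of `w`, which is the number of negative entries.
    (trans (map-∘ {g = λ (_ , t) → holes w , t} {f = state 1} (completions w))
    (cong (map _) (trans (fillAll-states (free 1 w) w (free-vals w) (AllPairs.filter⁺ (free? 1 w) (positives-< n)) above)
      (cong (λ c → fillStates c (state 1 w)) (Word.balanced W)))))
    where
    W = words-word n refl w∈
    above : ∀ {c y} → c ∈ free 1 w → y ∈ w → y ≡ bot ⊎ - c < y
    above c∈ y∈ = Sum.map₂ (λ (1≤y , _) → ℤ.<-≤-trans (ℤ.<-trans (-val<0 (free-vals w c∈)) (+<+ (s≤s z≤n))) 1≤y) (Word.atLeast W y∈)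
    negatives-holes : negatives w ≡ holes w
    negatives-holes = ∑-cong w λ {y} y∈ → ι-cong (y <? + 0) (y ≟ bot)
      (λ y<0 → [ id , (λ (1≤y , _) → contradiction 1≤y (ℤ.<⇒≱ (ℤ.<-trans y<0 (+<+ (s≤s z≤n))))) ]′ (Word.atLeast W y∈))
      λ { refl → -<+ }
    agree : ∀ {σ} → Signed σ → Completes (free 1 w) w σ → statistics σ ≡ (holes w , wex 1 σ , cr 1 σ , ne 1 σ)
    agree S ψ = cong₂ _,_ (trans (neg-negatives S) (trans (completes-negatives (free-vals w) ψ) negatives-holes))
      (cong₂ _,_ (wexB-wex S) (cong₂ _,_ (croB-cr S) (nesB-ne S)))

  statistics-↭ : map statistics (B n) ↭ concatMap finalStates (states n)
  statistics-↭ = ↭-trans (↭.map⁺ statistics B-↭) (↭-reflexive (trans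
    (map-concatMap-local statistics (state 1) completions finalStates (words 1 n) completions-statistics)
    (cong (concatMap finalStates) (words-states n refl))))

  statistics-symmetric : map statistics (B n) ↭ map mirror (map statistics (B n))
  statistics-symmetric = ↭-trans statistics-↭
    (↭-trans (concatMap-symmetric finalStates-equivariant (states-symmetric n))
    (↭.map⁺ mirror (↭-sym statistics-↭)))

theorem2p4 : (n : ℕ) → 1 ℕ.≤ n → (k l i j : ℕ) →
    countᵇ (λ σ → (wexB n σ ≡ᵇ k) ∧ (neg σ ≡ᵇ l) ∧ (croB n σ ≡ᵇ i) ∧ (nesB n σ ≡ᵇ j)) (B n)
    ≡ countᵇ (λ σ → (wexB n σ ≡ᵇ k) ∧ (neg σ ≡ᵇ l) ∧ (nesB n σ ≡ᵇ i) ∧ (croB n σ ≡ᵇ j)) (B n)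
theorem2p4 n _ k l i j = trans (count-states id)
  (trans (∑-↭ weight statistics-symmetric)
  (trans (∑-map weight mirror (map statistics (B n)))
  -- `match ∘ mirror ∘ statistics` unfolds to the condition in which `nesB` is compared with `i` and
  -- `croB` with `j`.
  (sym (count-states mirror))))
  where
  open PartialWords n
  match : State → Bool
  match (e , a , p , q) = (a ≡ᵇ k) ∧ (e ≡ᵇ l) ∧ (p ≡ᵇ i) ∧ (q ≡ᵇ j)
  weight : State → ℕ
  weight = χ ∘ match
  count-states : ∀ (f : State → State) → countᵇ (match ∘ f ∘ statistics) (B n) ≡ ∑ (map statistics (B n)) (weight ∘ f)
  count-states f = trans (countᵇ-∑ (match ∘ f ∘ statistics) (B n)) (sym (∑-map (weight ∘ f) statistics (B n)))
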